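{- The property $UN^=$ is undecidable for linear term rewrite systems that are left-flat and have right-hand sides of depth at most two. That is, there is no algorithm which, given a finite term rewrite system $R$ that is linear, all of whose left-hand sides are flat and all of whose right-hand sides have height at most two, decides whether $R$ is $UN^=$.
   Context: Terms are built from a finite signature $\mathcal{F}$ (function symbols with arities; arity-$0$ symbols are constants) and a countable set $X$ of variables disjoint from $\mathcal{F}$. The height (depth) of a constant or variable is $0$, and $\mathrm{height}(f(t_1,\dots,t_n))=1+\max_i \mathrm{height}(t_i)$ for $n>0$. A term is flat if its height is $0$ or $1$. A rewrite rule is a pair $l\to r$ of terms with $l\notin X$; it applies to a term by replacing a subterm of the form $l\sigma$ by $r\sigma$, $\sigma$ a substitution. A term rewrite system (TRS) is a finite set of rules. It is linear if in each rule every variable occurs at most once in the left-hand side and at most once in the right-hand side; it is left-flat if all left-hand sides are flat. $\overset{*}{\leftrightarrow}_R$ denotes the reflexive, symmetric, transitive closure of the one-step rewrite relation. A normal form is a term none of whose subterms can be rewritten. $R$ is $UN^=$ if there do not exist two distinct normal forms $M,N$ with $M\overset{*}{\leftrightarrow}_R N$. -}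

module Defs where

open import Data.Fin.Base using (Fin; toℕ)
open import Data.List.Base as List using (List; []; _∷_; _++_)
open import Data.List.Membership.Propositional using (_∈_)
open import Data.List.Relation.Unary.All using (All)
open import Data.List.Relation.Unary.Unique.Propositional using (Unique)
open import Data.Nat.Base using (ℕ; zero; suc; _+_; _⊔_; _≤_; _<_)
open import Data.Product.Base using (_×_; ∃; ∃₂)
open import Data.Vec.Base as Vec using (Vec; []; _∷_; lookup; _[_]≔_)
open import Data.Vec.Relation.Binary.Pointwise.Inductive using (Pointwise)
open import Relation.Binary.Construct.Closure.Equivalence using (EqClosure)
open import Relation.Binary.PropositionalEquality using (_≡_; _≢_)
open import Relation.Binary.Rewriting using (IsNormalForm)
open import Relation.Nullary.Negation.Core using (¬_)

------------------------------------------------------------------------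
-- Terms

record Signature : Set where
  field
    size  : ℕ
    arity : Fin size → ℕ

open Signature public

-- The countable set of variables is ℕ.
data Term (F : Signature) : Set where
  var : ℕ → Term F
  fun : (f : Fin (size F)) → Vec (Term F) (arity F f) → Term F

module _ {F : Signature} where

  nodeHeight : ∀ {n} → Vec ℕ n → ℕ
  nodeHeight []          = 0
  nodeHeight hs@(_ ∷ _) = 1 + Vec.foldr′ _⊔_ 0 hs

  mutual
    height : Term F → ℕ
    height (var x)    = 0
    height (fun f ts) = nodeHeight (heights ts)

    heights : ∀ {n} → Vec (Term F) n → Vec ℕ n
    heights []       = []
    heights (t ∷ ts) = height t ∷ heights ts

  Flat : Term F → Set
  Flat t = height t ≤ 1

  -- Variable occurrences from left to right, with repetitions.
  mutual
    vars : Term F → List ℕ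
    vars (var x)    = x ∷ []
    vars (fun f ts) = varsᵛ ts

    varsᵛ : ∀ {n} → Vec (Term F) n → List ℕ
    varsᵛ []       = []
    varsᵛ (t ∷ ts) = vars t ++ varsᵛ ts

  mutual
    subst : (ℕ → Term F) → Term F → Term F
    subst σ (var x)    = σ x
    subst σ (fun f ts) = fun f (substᵛ σ ts)

    substᵛ : ∀ {n} → (ℕ → Term F) → Vec (Term F) n → Vec (Term F) n
    substᵛ σ []       = []
    substᵛ σ (t ∷ ts) = subst σ t ∷ substᵛ σ ts

------------------------------------------------------------------------
-- Term rewrite systems

-- The right-hand side may contain variables that are absent from the
-- left-hand side.
record Rule (F : Signature) : Set where
  field
    lhs        : Term F
    rhs        : Term F
    lhs-nonvar : ∀ x → lhs ≢ var x

open Rule public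

-- The signature is part of the data of a TRS, so that it varies with the
-- instance of the decision problem.
record TRS : Set where
  field
    sig   : Signature
    rules : List (Rule sig)

open TRS public

data Step (R : TRS) : Term (sig R) → Term (sig R) → Set where
  root : ∀ {ρ} → ρ ∈ rules R → (σ : ℕ → Term (sig R)) →
         Step R (subst σ (lhs ρ)) (subst σ (rhs ρ))
  arg  : ∀ f (ts : Vec (Term (sig R)) (arity (sig R) f)) i {u} →
         Step R (lookup ts i) u →
         Step R (fun f ts) (fun f (ts [ i ]≔ u))

Linear : TRS → Set
Linear R = All (λ ρ → Unique (vars (lhs ρ)) × Unique (vars (rhs ρ))) (rules R)

LeftFlat : TRS → Set
LeftFlat R = All (λ ρ → Flat (lhs ρ)) (rules R)

RightHeight≤ : ℕ → TRS → Set
RightHeight≤ d R = All (λ ρ → height (rhs ρ) ≤ d) (rules R)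

UN⁼ : TRS → Set
UN⁼ R = ¬ ∃₂ λ M N →
  IsNormalForm (Step R) M × IsNormalForm (Step R) N × M ≢ N ×
  EqClosure (Step R) M N

------------------------------------------------------------------------
-- Algorithms: partial (μ-)recursive functions

data Rec : ℕ → Set where
  zer  : Rec 0
  succ : Rec 1
  proj : ∀ {n} → Fin n → Rec n
  comp : ∀ {m n} → Rec m → Vec (Rec n) m → Rec n
  prec : ∀ {n} → Rec n → Rec (2 + n) → Rec (1 + n)
  mu   : ∀ {n} → Rec (1 + n) → Rec n

-- p ⟨ xs ⟩⇓ y : the computation of p on arguments xs terminates with value y.
infix 4 _⟨_⟩⇓_

data _⟨_⟩⇓_ : ∀ {n} → Rec n → Vec ℕ n → ℕ → Set where
  zer⇓   : zer ⟨ [] ⟩⇓ 0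
  succ⇓  : ∀ {x} → succ ⟨ x ∷ [] ⟩⇓ suc x
  proj⇓  : ∀ {n} {xs : Vec ℕ n} i → proj i ⟨ xs ⟩⇓ lookup xs i
  comp⇓  : ∀ {m n} {g : Rec m} {hs : Vec (Rec n) m} {xs ys z} →
           Pointwise (λ h y → h ⟨ xs ⟩⇓ y) hs ys → g ⟨ ys ⟩⇓ z →
           comp g hs ⟨ xs ⟩⇓ z
  prec⇓₀ : ∀ {n} {g : Rec n} {h : Rec (2 + n)} {xs y} →
           g ⟨ xs ⟩⇓ y →
           prec g h ⟨ 0 ∷ xs ⟩⇓ y
  prec⇓₊ : ∀ {n} {g : Rec n} {h : Rec (2 + n)} {k xs r y} →
           prec g h ⟨ k ∷ xs ⟩⇓ r → h ⟨ k ∷ r ∷ xs ⟩⇓ y →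
           prec g h ⟨ suc k ∷ xs ⟩⇓ y
  mu⇓    : ∀ {n} {g : Rec (1 + n)} {xs k} →
           (∀ j → j < k → ∃ λ v → g ⟨ j ∷ xs ⟩⇓ suc v) →
           g ⟨ k ∷ xs ⟩⇓ 0 →
           mu g ⟨ xs ⟩⇓ k

------------------------------------------------------------------------
-- Presentation of finite TRSs as inputs of algorithms

triangular : ℕ → ℕ
triangular zero    = 0
triangular (suc n) = suc n + triangular n

-- Cantor's bijection ℕ × ℕ → ℕ.
pair : ℕ → ℕ → ℕ
pair a b = triangular (a + b) + b

codeList : List ℕ → ℕ
codeList []       = 0
codeList (n ∷ ns) = suc (pair n (codeList ns))

module _ {F : Signature} where

  -- First component 0 marks a variable, 1 + f the function symbol f.
  mutual
    codeTerm : Term F → ℕ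
    codeTerm (var x)    = pair 0 x
    codeTerm (fun f ts) = pair (suc (toℕ f)) (codeList (codeTerms ts))

    codeTerms : ∀ {n} → Vec (Term F) n → List ℕ
    codeTerms []       = []
    codeTerms (t ∷ ts) = codeTerm t ∷ codeTerms ts

  codeRule : Rule F → ℕ
  codeRule ρ = pair (codeTerm (lhs ρ)) (codeTerm (rhs ρ))

codeSignature : Signature → ℕ
codeSignature F = codeList (List.tabulate (arity F))

-- Injective up to pointwise equality of arity functions and irrelevance of
-- the lhs-nonvar proofs.
code : TRS → ℕ
code R = pair (codeSignature (sig R)) (codeList (List.map codeRule (rules R)))

{-# OPTIONS --safe #-}

-- A partial recursive function is compiled to a counter machine, and a machine
-- to a TRS whose terms q(s^n₁ 0, …, s^nₖ 0) are the configurations.  Since only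
-- the conversion relation matters, an instruction may be oriented either way:
-- "if xᵢ = s y, continue in q′ with y" becomes q′(…, xᵢ, …) → q(…, s xᵢ, …), so
-- that all left-hand sides are flat.  Identity rules make every symbol reducible
-- except two constants A and B; A is convertible to the initial configuration
-- and the accepting ones to B.  If the machine accepts, A and B are convertible
-- normal forms; if it does not, reading terms as numbers and configurations as
-- the proposition "the run from here accepts" separates all normal forms.
--
-- For a decision procedure p the machine computes p on the code of its own TRS.
-- The self-reference needs no recursion theorem: the TRS consists of a fixed part
-- together with b states that increment register 0, and b is chosen as the code of
-- the rules of the fixed part.
module Submission where

open import Defs
open import Data.Empty using (⊥; ⊥-elim)
open import Data.Fin.Base using (Fin; zero; suc; toℕ)
open import Data.Fin.Patterns
open import Data.Fin.Properties using (toℕ<n)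
open import Data.List.Base as List using (List; []; _∷_; _++_; length)
open import Data.List.Membership.Propositional using (_∈_)
open import Data.List.Membership.Propositional.Properties using (∈-++⁺ˡ; ∈-++⁺ʳ)
open import Data.List.Properties using (length-++; map-++; ++-assoc)
open import Data.List.Relation.Unary.All as All using (All; []; _∷_)
import Data.List.Relation.Unary.All.Properties as Allₚ
open import Data.List.Relation.Unary.AllPairs using ([]; _∷_)
open import Data.List.Relation.Unary.Any using (here; there)
open import Data.List.Relation.Unary.Unique.Propositional using (Unique)
open import Data.Nat.Base
open import Data.Nat.Properties
open import Data.Nat.Solver using (module +-*-Solver)
open import Data.Product.Base using (_×_; ∃; _,_; proj₁; proj₂)
open import Data.Sum.Base using (_⊎_; inj₁; inj₂)
open import Data.Unit.Base using (⊤; tt)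
open import Data.Vec.Base as Vec using (Vec; []; _∷_; _[_]≔_)
import Data.Vec.Properties as Vecₚ
open import Data.Vec.Relation.Binary.Pointwise.Inductive as Pointwise using (Pointwise; []; _∷_)
open import Data.Vec.Relation.Unary.All as Allᵛ using ([]; _∷_) renaming (All to Allᵛ)
open import Data.Vec.Relation.Unary.All.Properties using (lookup⁺)
open import Function.Base using (_∘_; const)
open import Function.Bundles using (_⇔_; mk⇔; Equivalence)
open import Function.Construct.Composition using (_⇔-∘_)
open import Function.Construct.Identity using (⇔-id)
open import Function.Construct.Symmetry using (⇔-sym)
open import Relation.Binary.Construct.Closure.Equivalence as Eq using (EqClosure)
open import Relation.Binary.Construct.Closure.ReflexiveTransitive using (ε; _◅_)
open import Relation.Binary.Construct.Closure.Symmetric using (fwd; bwd)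
open import Relation.Binary.Definitions using (tri<; tri≈; tri>)
open import Relation.Binary.PropositionalEquality renaming (subst to ≡-subst)
open import Relation.Binary.Rewriting using (IsNormalForm)
open import Relation.Nullary.Decidable using (yes; no)
open import Relation.Nullary.Negation.Core using (¬_; contradiction)

-- Register programs

-- The self-reference works because the code of the whole system is an explicit primitive recursive
-- function of b and five constants. Rules are listed with the highest label first, so the rules of
-- the b chain states are consed one at a time in front of the fixed rules. The code of a rule
-- mentions labels but not the number of states, so the fixed list has the same code for every b,
-- and b may be set equal to it without circularity.
--
-- The five constants are loaded by the program itself and so influence its length, which in turn
-- determines the labels. The circle is broken by taking the number of registers from the part that
-- does not load constants, and by loading in unary: the length is then a sum, which a suitable last
-- constant makes equal to twice that constant.
--
-- Halting of the program comes from the totality of the supposed decision procedure. On the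
-- rewriting side acceptance is kept as a proposition up to equivalence, so that the separation of
-- normal forms never has to decide it.

State : Set
State = ℕ → ℕ

-- Recursion on the index, instead of an equality test, mirrors `modify` on vectors and makes
-- `restrict-update` a direct induction.
update : ℕ → ℕ → State → State
update zero    n σ zero    = n
update zero    n σ (suc r) = σ (suc r)
update (suc i) n σ zero    = σ zero
update (suc i) n σ (suc r) = update i n (σ ∘ suc) r

update-same : ∀ i n σ → update i n σ i ≡ n
update-same zero    n σ = refl
update-same (suc i) n σ = update-same i n (σ ∘ suc)

update-other : ∀ i n σ r → r ≢ i → update i n σ r ≡ σ r
update-other zero    n σ zero    r≢i = contradiction refl r≢i
update-other zero    n σ (suc r) r≢i = refl
update-other (suc i) n σ zero    r≢i = refl
update-other (suc i) n σ (suc r) r≢i = update-other i n (σ ∘ suc) r (r≢i ∘ cong suc)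

-- loop i P means: while register i is nonzero, decrement it and run P.
data Cmd : Set where
  inc  : ℕ → Cmd
  loop : ℕ → List Cmd → Cmd

Prog : Set
Prog = List Cmd

infix 4 _⊢_⇒_

data _⊢_⇒_ : Prog → State → State → Set where
  done : ∀ {σ} → [] ⊢ σ ⇒ σ
  inc  : ∀ {i P σ τ} → P ⊢ update i (suc (σ i)) σ ⇒ τ → inc i ∷ P ⊢ σ ⇒ τ
  exit : ∀ {i B P σ τ} → σ i ≡ 0 → P ⊢ σ ⇒ τ → loop i B ∷ P ⊢ σ ⇒ τ
  iter : ∀ {i B P σ τ υ n} → σ i ≡ suc n →
         B ⊢ update i n σ ⇒ τ → loop i B ∷ P ⊢ τ ⇒ υ → loop i B ∷ P ⊢ σ ⇒ υ

⇒-++ : ∀ {P Q σ τ υ} → P ⊢ σ ⇒ τ → Q ⊢ τ ⇒ υ → P ++ Q ⊢ σ ⇒ υ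
⇒-++ done         e = e
⇒-++ (inc d)      e = inc (⇒-++ d e)
⇒-++ (exit z d)   e = exit z (⇒-++ d e)
⇒-++ (iter s b d) e = iter s b (⇒-++ d e)

infix 4 _≈_except_

_≈_except_ : State → State → ℕ → Set
τ ≈ σ except i = ∀ r → r ≢ i → τ r ≡ σ r

-- The final state is described register by register, since an equation between states would need
-- function extensionality.
Assigns : Prog → State → ℕ → ℕ → Set
Assigns P σ i y = ∃ λ τ → P ⊢ σ ⇒ τ × τ i ≡ y × τ ≈ σ except i

Adds : Prog → State → ℕ → ℕ → Set
Adds P σ i j = ∃ λ τ → P ⊢ σ ⇒ τ × τ i ≡ 0 × τ j ≡ σ i + σ j ×
                       (∀ r → r ≢ i → r ≢ j → τ r ≡ σ r)

-- Clearing, moving and copying registers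

inc-assigns : ∀ i σ → Assigns (inc i ∷ []) σ i (suc (σ i))
inc-assigns i σ = _ , inc done , update-same i _ σ , update-other i _ σ

clear : ℕ → Prog
clear i = loop i [] ∷ []

clear-assigns : ∀ i σ → Assigns (clear i) σ i 0
clear-assigns i σ = go (σ i) σ refl
  where
  go : ∀ n σ → σ i ≡ n → Assigns (clear i) σ i 0
  go zero    σ e = σ , exit e done , e , λ _ _ → refl
  go (suc n) σ e with go n (update i n σ) (update-same i n σ)
  ... | τ , run , z , fr =
    τ , iter e done run , z ,
    λ r r≢i → trans (fr r r≢i) (update-other i n σ r r≢i)

move : ℕ → ℕ → Prog
move i j = loop i (inc j ∷ []) ∷ []

move-adds : ∀ i j σ → i ≢ j → Adds (move i j) σ i j
move-adds i j σ i≢j = go (σ i) σ refl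
  where
  go : ∀ n σ → σ i ≡ n → Adds (move i j) σ i j
  go zero    σ e = σ , exit e done , e , cong (_+ σ j) (sym e) , λ _ _ _ → refl
  go (suc n) σ e with inc-assigns j (update i n σ)
  ... | τ₁ , run₁ , v₁ , fr₁
    with go n τ₁ (trans (fr₁ i i≢j) (update-same i n σ))
  ... | τ , run , z , v , fr = τ , iter e run₁ run , z , eq ,
        λ r r≢i r≢j → trans (fr r r≢i r≢j)
                        (trans (fr₁ r r≢j) (update-other i n σ r r≢i))
    where
    open ≡-Reasoning
    eq : τ j ≡ σ i + σ j
    eq = begin
      τ j                       ≡⟨ v ⟩
      τ₁ i + τ₁ j               ≡⟨ cong₂ _+_ (trans (fr₁ i i≢j) (update-same i n σ)) v₁ ⟩
      n + suc (update i n σ j)  ≡⟨ +-suc n _ ⟩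
      suc n + update i n σ j    ≡⟨ cong₂ _+_ (sym e) (update-other i n σ j (≢-sym i≢j)) ⟩
      σ i + σ j                 ∎

distribute : ℕ → ℕ → ℕ → Prog
distribute i j t = loop i (inc j ∷ inc t ∷ []) ∷ []

distribute-adds : ∀ i j t σ → i ≢ j → i ≢ t → j ≢ t →
  ∃ λ τ → distribute i j t ⊢ σ ⇒ τ × τ i ≡ 0 × τ j ≡ σ i + σ j × τ t ≡ σ i + σ t ×
          (∀ r → r ≢ i → r ≢ j → r ≢ t → τ r ≡ σ r)
distribute-adds i j t σ i≢j i≢t j≢t = go (σ i) σ refl
  where
  go : ∀ n σ → σ i ≡ n →
    ∃ λ τ → distribute i j t ⊢ σ ⇒ τ × τ i ≡ 0 × τ j ≡ σ i + σ j × τ t ≡ σ i + σ t ×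
            (∀ r → r ≢ i → r ≢ j → r ≢ t → τ r ≡ σ r)
  go zero    σ e = σ , exit e done , e , cong (_+ σ j) (sym e) , cong (_+ σ t) (sym e) ,
                   λ _ _ _ _ → refl
  go (suc n) σ e with inc-assigns j (update i n σ)
  ... | τ₁ , run₁ , v₁ , fr₁ with inc-assigns t τ₁
  ... | τ₂ , run₂ , v₂ , fr₂
    with go n τ₂ (trans (fr₂ i i≢t) (trans (fr₁ i i≢j) (update-same i n σ)))
  ... | τ , run , z , vj , vt , fr =
    τ , iter e (⇒-++ run₁ run₂) run , z , add vj τ₂j , add vt τ₂t ,
    λ r r≢i r≢j r≢t → trans (fr r r≢i r≢j r≢t)
      (trans (fr₂ r r≢t) (trans (fr₁ r r≢j) (update-other i n σ r r≢i)))
    where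
    τ₂i : τ₂ i ≡ n
    τ₂i = trans (fr₂ i i≢t) (trans (fr₁ i i≢j) (update-same i n σ))
    τ₂j : τ₂ j ≡ suc (σ j)
    τ₂j = trans (fr₂ j j≢t) (trans v₁ (cong suc (update-other i n σ j (≢-sym i≢j))))
    τ₂t : τ₂ t ≡ suc (σ t)
    τ₂t = trans v₂ (cong suc (trans (fr₁ t (≢-sym j≢t)) (update-other i n σ t (≢-sym i≢t))))
    add : ∀ {r} → τ r ≡ τ₂ i + τ₂ r → τ₂ r ≡ suc (σ r) → τ r ≡ σ i + σ r
    add {r} a b = trans a (trans (cong₂ _+_ τ₂i b) (trans (+-suc n (σ r)) (cong (_+ σ r) (sym e))))

-- A loop can read a register only by emptying it; `t` takes a second copy from which `i` is
-- restored.
copy : ℕ → ℕ → ℕ → Prog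
copy i j t = distribute i j t ++ move t i

copy-assigns : ∀ i j t σ → i ≢ j → i ≢ t → j ≢ t → σ j ≡ 0 → σ t ≡ 0 →
  Assigns (copy i j t) σ j (σ i)
copy-assigns i j t σ i≢j i≢t j≢t σj σt with distribute-adds i j t σ i≢j i≢t j≢t
... | τ₁ , run₁ , zi , vj , vt , fr₁ with move-adds t i τ₁ (≢-sym i≢t)
... | τ , run , zt , vi , fr =
  τ , ⇒-++ run₁ run ,
  trans (fr j j≢t (≢-sym i≢j)) (trans vj (trans (cong (σ i +_) σj) (+-identityʳ _))) ,
  frame
  where
  open ≡-Reasoning
  frame : ∀ r → r ≢ j → τ r ≡ σ r
  frame r r≢j with r ≟ i | r ≟ t
  ... | yes refl | _ = begin
        τ i           ≡⟨ vi ⟩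
        τ₁ t + τ₁ i   ≡⟨ cong₂ _+_ vt zi ⟩
        σ i + σ t + 0 ≡⟨ +-identityʳ _ ⟩
        σ i + σ t     ≡⟨ cong (σ i +_) σt ⟩
        σ i + 0       ≡⟨ +-identityʳ _ ⟩
        σ i           ∎
  ... | no _ | yes refl = trans zt (sym σt)
  ... | no r≢i | no r≢t = trans (fr r r≢t r≢i) (fr₁ r r≢i r≢j r≢t)

clearRange : ℕ → ℕ → Prog
clearRange f zero    = []
clearRange f (suc m) = clear f ++ clearRange (suc f) m

clearRange-clears : ∀ f m σ → ∃ λ τ → clearRange f m ⊢ σ ⇒ τ ×
  (∀ r → f ≤ r → r < f + m → τ r ≡ 0) ×
  (∀ r → r < f ⊎ f + m ≤ r → τ r ≡ σ r)
clearRange-clears f zero σ =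
  σ , done ,
  (λ r f≤r r< → contradiction (<-≤-trans r< (≤-trans (≤-reflexive (+-identityʳ f)) f≤r)) (<-irrefl refl)) ,
  λ _ _ → refl
clearRange-clears f (suc m) σ with clear-assigns f σ
... | τ₁ , run₁ , z₁ , fr₁ with clearRange-clears (suc f) m τ₁
... | τ , run , z , fr = τ , ⇒-++ run₁ run , zero-on , frame
  where
  zero-on : ∀ r → f ≤ r → r < f + suc m → τ r ≡ 0
  zero-on r f≤r r< with r ≟ f
  ... | yes refl = trans (fr f (inj₁ (n<1+n f))) z₁
  ... | no r≢f   = z r (≤∧≢⇒< f≤r (≢-sym r≢f)) (≡-subst (r <_) (+-suc f m) r<)
  frame : ∀ r → r < f ⊎ f + suc m ≤ r → τ r ≡ σ r
  frame r (inj₁ r<f) = trans (fr r (inj₁ (m<n⇒m<1+n r<f))) (fr₁ r (<⇒≢ r<f))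
  frame r (inj₂ f+m≤r) =
    trans (fr r (inj₂ (≤-trans (≤-reflexive (sym (+-suc f m))) f+m≤r)))
          (fr₁ r (≢-sym (<⇒≢ (<-≤-trans (m<m+n f z<s) f+m≤r))))

-- Compilation of recursive functions

range : ℕ → (m : ℕ) → Vec ℕ m
range f zero    = []
range f (suc m) = f ∷ range (suc f) m

mutual
  -- The result goes to out; the registers from f on are scratch, zero before and
  -- after.
  compile : ∀ {n} → Rec n → Vec ℕ n → ℕ → ℕ → Prog
  compile zer         ins           out f = []
  compile succ        (i ∷ [])      out f = copy i out f ++ inc out ∷ []
  compile (proj i)    ins           out f = copy (Vec.lookup ins i) out f
  compile (comp {m} g hs) ins       out f =
    compileAll hs ins f (f + m) ++ compile g (range f m) out (f + m) ++ clearRange f m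
  compile (prec g h)  (c ∷ ins)     out f =
    copy c f (suc f) ++ compile g ins out (3 + f) ++
    loop f (precBody h ins out f) ∷ clear (suc f)
  compile (mu g)      ins           out f =
    compile g (out ∷ ins) f (suc f) ++ loop f (muBody g ins out f) ∷ []

  compileAll : ∀ {m n} → Vec (Rec n) m → Vec ℕ n → ℕ → ℕ → Prog
  compileAll []       ins d f = []
  compileAll (h ∷ hs) ins d f = compile h ins d f ++ compileAll hs ins (suc d) f

  -- Register `f` counts the iterations still to come, `suc f` those already done, and `out` holds
  -- the current value. The next value is built in `2 + f`, because `out` is an input of `h`.
  precBody : ∀ {n} → Rec (2 + n) → Vec ℕ n → ℕ → ℕ → Prog
  precBody h ins out f =
    compile h (suc f ∷ out ∷ ins) (2 + f) (3 + f) ++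
    clear out ++ move (2 + f) out ++ inc (suc f) ∷ []

  -- `out` itself is the candidate and `f` the value of `g` at it. The loop takes only one unit off
  -- a nonzero value, so `f` is cleared before it receives the next one.
  muBody : ∀ {n} → Rec (1 + n) → Vec ℕ n → ℕ → ℕ → Prog
  muBody g ins out f = clear f ++ inc out ∷ compile g (out ∷ ins) f (suc f)

-- Correctness of the compilation

map-cong-on : ∀ {n} {P : ℕ → Set} {σ τ : State} {ins : Vec ℕ n} →
  Allᵛ P ins → (∀ r → P r → τ r ≡ σ r) → Vec.map τ ins ≡ Vec.map σ ins
map-cong-on []         eq = refl
map-cong-on (px ∷ pxs) eq = cong₂ _∷_ (eq _ px) (map-cong-on pxs eq)

-- Inputs avoid `out` because it changes while they are still being read, as in the loops for `prec`
-- and `mu`.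
Input : ℕ → ℕ → ℕ → Set
Input out f r = r < f × r ≢ out

record Correct {n} (p : Rec n) (xs : Vec ℕ n) (y : ℕ) : Set where
  field
    assigns : ∀ {ins out f σ} →
      Allᵛ (Input out f) ins → out < f → σ out ≡ 0 → (∀ r → f ≤ r → σ r ≡ 0) →
      Vec.map σ ins ≡ xs → Assigns (compile p ins out f) σ out y

open Correct

range-bounds : ∀ f m → Allᵛ (λ r → f ≤ r × r < f + m) (range f m)
range-bounds f zero    = []
range-bounds f (suc m) =
  (≤-refl , m<m+n f z<s) ∷
  Allᵛ.map (λ (a , b) → <⇒≤ a , ≤-trans b (≤-reflexive (sym (+-suc f m)))) (range-bounds (suc f) m)

succ-correct : ∀ {x} → Correct succ (x ∷ []) (suc x)
succ-correct .assigns {ins = i ∷ []} {out} {f} {σ} ((i<f , i≢o) ∷ []) o<f σo σf refl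
  with copy-assigns i out f σ i≢o (<⇒≢ i<f) (<⇒≢ o<f) σo (σf f ≤-refl)
... | τ₁ , run₁ , v₁ , fr₁ with inc-assigns out τ₁
... | τ , run , v , fr = τ , ⇒-++ run₁ run , trans v (cong suc v₁) ,
      λ r r≢o → trans (fr r r≢o) (fr₁ r r≢o)

proj-correct : ∀ {n} (i : Fin n) xs → Correct (proj i) xs (Vec.lookup xs i)
proj-correct i xs .assigns {ins} {out} {f} {σ} ok o<f σo σf refl
  with lookup⁺ ok i
... | i<f , i≢o rewrite Vecₚ.lookup-map i σ ins =
  copy-assigns (Vec.lookup ins i) out f σ i≢o (<⇒≢ i<f) (<⇒≢ o<f) σo (σf f ≤-refl)

compileAll-correct : ∀ {m n} {hs : Vec (Rec n) m} {xs ys} →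
  Pointwise (λ h y → Correct h xs y) hs ys →
  ∀ {ins d f σ} → Allᵛ (_< d) ins → d + m ≤ f → (∀ r → d ≤ r → σ r ≡ 0) →
  Vec.map σ ins ≡ xs →
  ∃ λ τ → compileAll hs ins d f ⊢ σ ⇒ τ × Vec.map τ (range d m) ≡ ys ×
          (∀ r → r < d ⊎ f ≤ r → τ r ≡ σ r)
compileAll-correct [] ok d≤f σd eq = _ , done , refl , λ _ _ → refl
compileAll-correct {suc m} (c ∷ cs) {ins} {d} {f} {σ} ok d+m≤f σd eq
  with c .assigns {ins} {d} {f} {σ} (Allᵛ.map (λ r<d → <-trans r<d d<f , <⇒≢ r<d) ok) d<f
         (σd d ≤-refl) (λ r f≤r → σd r (≤-trans (<⇒≤ d<f) f≤r)) eq
  where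
  d<f : d < f
  d<f = <-≤-trans (m<m+n d z<s) d+m≤f
... | τ₁ , run₁ , v₁ , fr₁
  with compileAll-correct cs {ins} {suc d} {f} {τ₁} (Allᵛ.map m<n⇒m<1+n ok)
         (≤-trans (≤-reflexive (sym (+-suc d m))) d+m≤f)
         (λ r d<r → trans (fr₁ r (≢-sym (<⇒≢ d<r))) (σd r (<⇒≤ d<r)))
         (trans (map-cong-on ok λ r r<d → fr₁ r (<⇒≢ r<d)) eq)
... | τ , run , vs , fr = τ , ⇒-++ run₁ run ,
  cong₂ _∷_ (trans (fr d (inj₁ (n<1+n d))) v₁) vs , frame
  where
  frame : ∀ r → r < d ⊎ f ≤ r → τ r ≡ σ r
  frame r (inj₁ r<d) = trans (fr r (inj₁ (m<n⇒m<1+n r<d))) (fr₁ r (<⇒≢ r<d))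
  frame r (inj₂ f≤r) = trans (fr r (inj₂ f≤r))
    (fr₁ r (≢-sym (<⇒≢ (<-≤-trans (<-≤-trans (m<m+n d z<s) d+m≤f) f≤r))))

comp-correct : ∀ {m n} {g : Rec m} {hs : Vec (Rec n) m} {xs ys z} →
  Pointwise (λ h y → Correct h xs y) hs ys → Correct g ys z → Correct (comp g hs) xs z
comp-correct {m} cs cg .assigns {ins} {out} {f} {σ} ok o<f σo σf eq
  with compileAll-correct cs {ins} {f} {f + m} {σ} (Allᵛ.map proj₁ ok) ≤-refl σf eq
... | τ₁ , run₁ , vs , fr₁
  with cg .assigns {range f m} {out} {f + m} {τ₁}
         (Allᵛ.map (λ (f≤r , r<) → r< , ≢-sym (<⇒≢ (<-≤-trans o<f f≤r))) (range-bounds f m))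
         (<-≤-trans o<f (m≤m+n f m)) (trans (fr₁ out (inj₁ o<f)) σo)
         (λ r f+m≤r → trans (fr₁ r (inj₂ f+m≤r)) (σf r (≤-trans (m≤m+n f m) f+m≤r))) vs
... | τ₂ , run₂ , v₂ , fr₂ with clearRange-clears f m τ₂
... | τ , run , z , fr =
  τ , ⇒-++ run₁ (⇒-++ run₂ run) , trans (fr out (inj₁ o<f)) v₂ , frame
  where
  outside : ∀ r → r ≢ out → r < f ⊎ f + m ≤ r → τ r ≡ σ r
  outside r r≢o far = trans (fr r far) (trans (fr₂ r r≢o) (fr₁ r far))
  frame : ∀ r → r ≢ out → τ r ≡ σ r
  frame r r≢o with r <? f | r <? f + m
  ... | yes r<f | _      = outside r r≢o (inj₁ r<f)
  ... | no  r≮f | yes r< = trans (z r (≮⇒≥ r≮f) r<) (sym (σf r (≮⇒≥ r≮f)))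
  ... | no  _   | no  r≮ = outside r r≢o (inj₂ (≮⇒≥ r≮))

-- The loop invariant after k iterations, with j still to come. The relation `_⊢_⇒_` describes only
-- complete runs, while the state `τ` is met at the head of the loop; hence the last component says
-- that every run from there extends to one from the beginning.
record PrecRuns {n} (g : Rec n) (h : Rec (2 + n)) (k : ℕ) (xs : Vec ℕ n) (y : ℕ) : Set where
  field
    runs : ∀ {ins out f σ} j →
      Allᵛ (Input out f) ins → out < f → σ out ≡ 0 → σ f ≡ k + j →
      (∀ r → f < r → σ r ≡ 0) → Vec.map σ ins ≡ xs →
      ∃ λ τ → τ f ≡ j × τ (suc f) ≡ k × τ out ≡ y × (∀ r → suc f < r → τ r ≡ 0) ×
              (∀ r → r < f → r ≢ out → τ r ≡ σ r) ×
              (∀ {P υ} → loop f (precBody h ins out f) ∷ P ⊢ τ ⇒ υ →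
                 compile g ins out (3 + f) ++ loop f (precBody h ins out f) ∷ P ⊢ σ ⇒ υ)

open PrecRuns

prec-runs-zero : ∀ {n} {g : Rec n} {h xs y} → Correct g xs y → PrecRuns g h 0 xs y
prec-runs-zero cg .runs {f = f} {σ} j ok o<f σo σf≡ σf eq
  with cg .assigns (Allᵛ.map (λ (r<f , r≢o) → <-≤-trans r<f (m≤n+m f 3) , r≢o) ok)
          (<-≤-trans o<f (m≤n+m f 3)) σo (λ r f+3≤r → σf r (≤-trans (m≤n+m (suc f) 2) f+3≤r)) eq
... | τ , run , v , fr =
  τ , trans (fr f (≢-sym (<⇒≢ o<f))) σf≡ ,
  fresh (suc f) (n<1+n f) , v , (λ r f<r → fresh r (<-trans (n<1+n f) f<r)) ,
  (λ r _ r≢o → fr r r≢o) , ⇒-++ run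
  where
  fresh : ∀ r → f < r → τ r ≡ 0
  fresh r f<r = trans (fr r (≢-sym (<⇒≢ (<-trans o<f f<r)))) (σf r f<r)

prec-runs-suc : ∀ {n} {g : Rec n} {h k xs y z} →
  PrecRuns g h k xs y → Correct h (k ∷ y ∷ xs) z → PrecRuns g h (suc k) xs z
prec-runs-suc {k = k} ih ch .runs {ins} {out} {f} {σ} j ok o<f σo σf≡ σf eq
  -- The first k iterations leave `suc j` in register `f`; the iteration treated here leaves j.
  with ih .runs {ins} {out} {f} {σ} (suc j) ok o<f σo (trans σf≡ (sym (+-suc k j))) σf eq
... | τ , τf , τk , τo , τz , τfr , cont
  with ch .assigns {suc f ∷ out ∷ ins} {2 + f} {3 + f} {update f j τ}
          ((m<n⇒m<1+n (n<1+n (suc f)) , <⇒≢ (n<1+n (suc f))) ∷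
           (<-trans o<f (<-trans (n<1+n f) (m<n⇒m<1+n (n<1+n (suc f)))) , <⇒≢ (<-trans o<f (<-trans (n<1+n f) (n<1+n (suc f))))) ∷
           Allᵛ.map (λ (r<f , _) → <-≤-trans r<f (m≤n+m f 3) , <⇒≢ (<-≤-trans r<f (m≤n+m f 2))) ok)
          (n<1+n (2 + f))
          (trans (update-other f j τ (2 + f) (≢-sym (<⇒≢ (m<n⇒m<1+n (n<1+n f))))) (τz _ (n<1+n (suc f))))
          (λ r f+3≤r → trans (update-other f j τ r (≢-sym (<⇒≢ (≤-trans (m≤n+m (suc f) 2) f+3≤r))))
                             (τz r (≤-trans (n≤1+n (2 + f)) f+3≤r)))
          (cong₂ _∷_ (trans (update-other f j τ (suc f) (≢-sym (<⇒≢ (n<1+n f)))) τk)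
            (cong₂ _∷_ (trans (update-other f j τ out (<⇒≢ o<f)) τo)
              (trans (map-cong-on ok λ r (r<f , r≢o) → trans (update-other f j τ r (<⇒≢ r<f)) (τfr r r<f r≢o)) eq)))
... | τ₁ , run₁ , v₁ , fr₁ with clear-assigns out τ₁
... | τ₂ , run₂ , v₂ , fr₂ with move-adds (2 + f) out τ₂ (≢-sym (<⇒≢ (<-≤-trans o<f (m≤n+m f 2))))
... | τ₃ , run₃ , z₃ , v₃ , fr₃ with inc-assigns (suc f) τ₃
... | τ₄ , run₄ , v₄ , fr₄ =
  τ₄ ,
  trans (keep f f≢f+1 f≢o f≢f+2) (update-same f j τ) ,
  trans v₄ (cong suc (trans (fr₃ (suc f) f+1≢f+2 f+1≢o)
    (trans (fr₂ (suc f) f+1≢o) (trans (fr₁ (suc f) f+1≢f+2)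
      (trans (update-other f j τ (suc f) (≢-sym f≢f+1)) τk))))) ,
  trans (fr₄ out (≢-sym f+1≢o)) (trans v₃ (trans (cong₂ _+_ (trans (fr₂ (2 + f) f+2≢o) v₁) v₂) (+-identityʳ _))) ,
  high ,
  (λ r r<f r≢o → trans (keep r (<⇒≢ (m<n⇒m<1+n r<f)) r≢o (<⇒≢ (<-≤-trans r<f (m≤n+m f 2))))
                    (trans (update-other f j τ r (<⇒≢ r<f)) (τfr r r<f r≢o))) ,
  λ run → cont (iter τf (⇒-++ run₁ (⇒-++ run₂ (⇒-++ run₃ run₄))) run)
  where
  f≢f+1 : f ≢ suc f
  f≢f+1 = <⇒≢ (n<1+n f)
  f≢f+2 : f ≢ 2 + f
  f≢f+2 = <⇒≢ (m<n⇒m<1+n (n<1+n f))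
  f+1≢f+2 : suc f ≢ 2 + f
  f+1≢f+2 = <⇒≢ (n<1+n (suc f))
  f≢o : f ≢ out
  f≢o = ≢-sym (<⇒≢ o<f)
  f+1≢o : suc f ≢ out
  f+1≢o = ≢-sym (<⇒≢ (m<n⇒m<1+n o<f))
  f+2≢o : 2 + f ≢ out
  f+2≢o = ≢-sym (<⇒≢ (<-≤-trans o<f (m≤n+m f 2)))
  keep : ∀ r → r ≢ suc f → r ≢ out → r ≢ 2 + f → τ₄ r ≡ update f j τ r
  keep r r≢ r≢o r≢' = trans (fr₄ r r≢) (trans (fr₃ r r≢' r≢o) (trans (fr₂ r r≢o) (fr₁ r r≢')))
  high : ∀ r → suc f < r → τ₄ r ≡ 0
  high r f+1<r with r ≟ 2 + f
  ... | yes refl = trans (fr₄ r (≢-sym f+1≢f+2)) z₃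
  ... | no r≢ = trans (keep r (≢-sym (<⇒≢ f+1<r)) (≢-sym (<⇒≢ (<-trans (m<n⇒m<1+n o<f) f+1<r))) r≢)
                  (trans (update-other f j τ r (≢-sym (<⇒≢ (<-trans (n<1+n f) f+1<r)))) (τz r f+1<r))

prec-correct : ∀ {n} {g : Rec n} {h k xs y} →
  PrecRuns g h k xs y → Correct (prec g h) (k ∷ xs) y
prec-correct {k = k} pr .assigns {c ∷ ins} {out} {f} {σ} ((c<f , c≢o) ∷ ok) o<f σo σf eq
  with copy-assigns c f (suc f) σ (<⇒≢ c<f) (<⇒≢ (m<n⇒m<1+n c<f)) (<⇒≢ (n<1+n f))
         (σf f ≤-refl) (σf (suc f) (n≤1+n f))
... | τ₁ , run₁ , v₁ , fr₁
  with pr .runs {ins} {out} {f} {τ₁} 0 ok o<f (trans (fr₁ out (<⇒≢ o<f)) σo)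
         (trans v₁ (trans (cong Vec.head eq) (sym (+-identityʳ k))))
         (λ r f<r → trans (fr₁ r (≢-sym (<⇒≢ f<r))) (σf r (<⇒≤ f<r)))
         (trans (map-cong-on ok λ r (r<f , _) → fr₁ r (<⇒≢ r<f)) (cong Vec.tail eq))
... | τ₂ , τf , _ , τo , τz , τfr , cont with clear-assigns (suc f) τ₂
... | τ , run , z , fr =
  τ , ⇒-++ run₁ (cont (exit τf run)) , trans (fr out (<⇒≢ (m<n⇒m<1+n o<f))) τo , frame
  where
  frame : ∀ r → r ≢ out → τ r ≡ σ r
  frame r r≢o with <-cmp r f | r ≟ suc f
  ... | _ | yes refl = trans z (sym (σf (suc f) (n≤1+n f)))
  ... | tri< r<f r≢f _ | no r≢ = trans (fr r r≢) (trans (τfr r r<f r≢o) (fr₁ r r≢f))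
  ... | tri≈ _ refl _ | no r≢ = trans (fr f r≢) (trans τf (sym (σf f ≤-refl)))
  ... | tri> _ _ f<r | no r≢ =
    trans (fr r r≢) (trans (τz r (≤∧≢⇒< f<r (≢-sym r≢))) (sym (σf r (<⇒≤ f<r))))

mu-correct : ∀ {n} {g : Rec (1 + n)} {xs k} →
  (∀ j → j < k → ∃ λ v → Correct g (j ∷ xs) (suc v)) → Correct g (k ∷ xs) 0 →
  Correct (mu g) xs k
mu-correct {g = g} {xs} {k} below at .assigns {ins} {out} {f} {σ} ok o<f σo σf eq
  with search k 0 (+-identityʳ k) σ σo (σf f ≤-refl) (λ _ _ _ → refl)
  where
  -- Induction on the distance d from the candidate j to k. The test of j and the loop after it are
  -- separate runs, because the loop body ends with the test of the next candidate and has to absorb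
  -- it.
  search : ∀ d j → d + j ≡ k → ∀ τ → τ out ≡ j → τ f ≡ 0 →
    (∀ r → r ≢ out → r ≢ f → τ r ≡ σ r) →
    ∃ λ υ → ∃ λ ω → compile g (out ∷ ins) f (suc f) ⊢ τ ⇒ υ ×
      loop f (muBody g ins out f) ∷ [] ⊢ υ ⇒ ω ×
      ω out ≡ k × ω f ≡ 0 × (∀ r → r ≢ out → r ≢ f → ω r ≡ σ r)
  search d j d+j≡k τ τo τf τfr = go d d+j≡k
    where
    G : ∀ {y} → Correct g (j ∷ xs) y → Assigns (compile g (out ∷ ins) f (suc f)) τ f y
    G c = c .assigns {out ∷ ins} {f} {suc f} {τ}
      ((m<n⇒m<1+n o<f , <⇒≢ o<f) ∷ Allᵛ.map (λ (r<f , _) → m<n⇒m<1+n r<f , <⇒≢ r<f) ok)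
      (n<1+n f) τf
      (λ r f<r → trans (τfr r (≢-sym (<⇒≢ (<-trans o<f f<r))) (≢-sym (<⇒≢ f<r))) (σf r (<⇒≤ f<r)))
      (cong₂ _∷_ τo (trans (map-cong-on ok λ r (r<f , r≢o) → τfr r r≢o (<⇒≢ r<f)) eq))
    go : ∀ d → d + j ≡ k → ∃ λ υ → ∃ λ ω → compile g (out ∷ ins) f (suc f) ⊢ τ ⇒ υ ×
      loop f (muBody g ins out f) ∷ [] ⊢ υ ⇒ ω ×
      ω out ≡ k × ω f ≡ 0 × (∀ r → r ≢ out → r ≢ f → ω r ≡ σ r)
    go zero refl with G at
    ... | υ , run , v , fr = υ , υ , run , exit v done , trans (fr out (<⇒≢ o<f)) τo , v ,
          λ r r≢o r≢f → trans (fr r r≢f) (τfr r r≢o r≢f)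
    go (suc d) e with G (proj₂ (below j (≤-trans (s≤s (m≤n+m j d)) (≤-reflexive e))))
    ... | υ , run , v , fr with clear-assigns f (update f _ υ)
    ... | υ₁ , run₁ , v₁ , fr₁ with inc-assigns out υ₁
    ... | υ₂ , run₂ , v₂ , fr₂
      with search d (suc j) (trans (+-suc d j) e) υ₂
             (trans v₂ (cong suc (trans (fr₁ out (<⇒≢ o<f))
               (trans (update-other f _ υ out (<⇒≢ o<f)) (trans (fr out (<⇒≢ o<f)) τo)))))
             (trans (fr₂ f (≢-sym (<⇒≢ o<f))) v₁)
             (λ r r≢o r≢f → trans (fr₂ r r≢o) (trans (fr₁ r r≢f)
               (trans (update-other f _ υ r r≢f) (trans (fr r r≢f) (τfr r r≢o r≢f)))))
    ... | υ₃ , ω , run₃ , rest , p = υ , ω , run , iter v (⇒-++ run₁ (⇒-++ run₂ run₃)) rest , p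
... | υ , ω , run , rest , ωo , ωf , fr = ω , ⇒-++ run rest , ωo , frame
  where
  frame : ∀ r → r ≢ out → ω r ≡ σ r
  frame r r≢o with r ≟ f
  ... | yes refl = trans ωf (sym (σf f ≤-refl))
  ... | no r≢f = fr r r≢o r≢f

mutual
  compile-correct : ∀ {n} {p : Rec n} {xs y} → p ⟨ xs ⟩⇓ y → Correct p xs y
  compile-correct zer⇓                 = record { assigns = λ _ _ σo _ _ → _ , done , σo , λ _ _ → refl }
  compile-correct succ⇓                = succ-correct
  compile-correct (proj⇓ {xs = xs} i)  = proj-correct i xs
  compile-correct (comp⇓ ds d)         = comp-correct (compile-correctᵛ ds) (compile-correct d)
  compile-correct (prec⇓₀ d)           = prec-correct (prec-runs (prec⇓₀ d))
  compile-correct (prec⇓₊ d e)         = prec-correct (prec-runs (prec⇓₊ d e))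
  compile-correct (mu⇓ ds d)           =
    mu-correct (λ j j<k → compile-correct⁺ (ds j j<k)) (compile-correct d)

  compile-correctᵛ : ∀ {m n} {hs : Vec (Rec n) m} {xs ys} →
    Pointwise (λ h y → h ⟨ xs ⟩⇓ y) hs ys → Pointwise (λ h y → Correct h xs y) hs ys
  compile-correctᵛ []       = []
  compile-correctᵛ (d ∷ ds) = compile-correct d ∷ compile-correctᵛ ds

  -- Matching on the whole pair supplied by the premise of `mu⇓` keeps the recursion visibly
  -- structural.
  compile-correct⁺ : ∀ {n} {p : Rec n} {xs} →
    (∃ λ v → p ⟨ xs ⟩⇓ suc v) → ∃ λ v → Correct p xs (suc v)
  compile-correct⁺ (v , d) = v , compile-correct d

  -- Recursion along a `prec` derivation has to carry the loop invariant: correctness of the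
  -- complete program for k says nothing about a loop entered with a larger counter.
  prec-runs : ∀ {n} {g : Rec n} {h k xs y} → prec g h ⟨ k ∷ xs ⟩⇓ y → PrecRuns g h k xs y
  prec-runs (prec⇓₀ d)   = prec-runs-zero (compile-correct d)
  prec-runs (prec⇓₊ d e) = prec-runs-suc (prec-runs d) (compile-correct e)

-- Counter machines

data Instr : Set where
  inc : ℕ → ℕ → Instr
  jz  : ℕ → ℕ → ℕ → Instr
  jmp : ℕ → Instr
  acc : Instr

get : ∀ {k} → ℕ → Vec ℕ k → ℕ
get i       []       = 0
get zero    (n ∷ ns) = n
get (suc i) (n ∷ ns) = get i ns

-- Polymorphic, because the same operation acts on register contents, on argument terms and on codes
-- of argument terms.
modify : ∀ {A : Set} {k} → ℕ → (A → A) → Vec A k → Vec A k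
modify i       g []       = []
modify zero    g (x ∷ xs) = g x ∷ xs
modify (suc i) g (x ∷ xs) = x ∷ modify i g xs

modify-∘ : ∀ {A : Set} {k} i (g h : A → A) (xs : Vec A k) →
  modify i g (modify i h xs) ≡ modify i (g ∘ h) xs
modify-∘ i       g h []       = refl
modify-∘ zero    g h (x ∷ xs) = refl
modify-∘ (suc i) g h (x ∷ xs) = cong (x ∷_) (modify-∘ i g h xs)

modify-id : ∀ {A : Set} {k} i (xs : Vec A k) → modify i (λ x → x) xs ≡ xs
modify-id i       []       = refl
modify-id zero    (x ∷ xs) = refl
modify-id (suc i) (x ∷ xs) = cong (x ∷_) (modify-id i xs)

modify-fixed : ∀ {k} i (g : ℕ → ℕ) (v : Vec ℕ k) → g (get i v) ≡ get i v → modify i g v ≡ v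
modify-fixed i       g []      e = refl
modify-fixed zero    g (n ∷ v) e = cong (_∷ v) e
modify-fixed (suc i) g (n ∷ v) e = cong (n ∷_) (modify-fixed i g v e)

get-modify : ∀ {k} i g (v : Vec ℕ k) → i < k → get i (modify i g v) ≡ g (get i v)
get-modify zero    g (n ∷ v) _         = refl
get-modify (suc i) g (n ∷ v) (s≤s i<k) = get-modify i g v i<k

get-modify-0 : ∀ {k} i (v : Vec ℕ k) → get i (modify i (const 0) v) ≡ 0
get-modify-0 i       []      = refl
get-modify-0 zero    (n ∷ v) = refl
get-modify-0 (suc i) (n ∷ v) = get-modify-0 i v

restrict : ∀ k → State → Vec ℕ k
restrict zero    σ = []
restrict (suc k) σ = σ 0 ∷ restrict k (σ ∘ suc)

get-restrict : ∀ {k} i σ → i < k → get i (restrict k σ) ≡ σ i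
get-restrict {suc k} zero    σ _         = refl
get-restrict {suc k} (suc i) σ (s≤s i<k) = get-restrict i (σ ∘ suc) i<k

restrict-update : ∀ k i n (g : ℕ → ℕ) σ → n ≡ g (σ i) →
  restrict k (update i n σ) ≡ modify i g (restrict k σ)
restrict-update zero    i       n g σ e = refl
restrict-update (suc k) zero    n g σ e = cong (_∷ _) e
restrict-update (suc k) (suc i) n g σ e = cong (σ 0 ∷_) (restrict-update k i n g (σ ∘ suc) e)

-- assemble P l occupies the labels l, …, l + width P - 1 and ends by falling
-- through to the label l + width P.
width : Prog → ℕ
width []             = 0
width (inc i ∷ P)    = suc (width P)
width (loop i B ∷ P) = suc (width B + suc (width P))

assemble : Prog → ℕ → List Instr
assemble []             l = []
assemble (inc i ∷ P)    l = inc i (suc l) ∷ assemble P (suc l)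
assemble (loop i B ∷ P) l =
  jz i (2 + (l + width B)) (suc l) ∷ assemble B (suc l) ++ jmp l ∷ assemble P (2 + (l + width B))

length-assemble : ∀ P l → length (assemble P l) ≡ width P
length-assemble []             l = refl
length-assemble (inc i ∷ P)    l = cong suc (length-assemble P (suc l))
length-assemble (loop i B ∷ P) l = cong suc
  (trans (length-++ (assemble B (suc l)))
         (cong₂ (λ m n → m + suc n) (length-assemble B (suc l)) (length-assemble P _)))

width-++ : ∀ P Q → width (P ++ Q) ≡ width P + width Q
width-++ []             Q = refl
width-++ (inc i ∷ P)    Q = cong suc (width-++ P Q)
width-++ (loop i B ∷ P) Q = cong suc
  (trans (cong (λ n → width B + suc n) (width-++ P Q)) (sym (+-assoc (width B) (suc (width P)) (width Q))))

Below : ℕ → Prog → Set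
Below k []             = ⊤
Below k (inc i ∷ P)    = i < k × Below k P
Below k (loop i B ∷ P) = i < k × Below k B × Below k P

below-++ : ∀ {k} P {Q} → Below k P → Below k Q → Below k (P ++ Q)
below-++ []             p           q = q
below-++ (inc i ∷ P)    (i<k , p)     q = i<k , below-++ P p q
below-++ (loop i B ∷ P) (i<k , b , p) q = i<k , b , below-++ P p q

below-mono : ∀ {k k′} P → k ≤ k′ → Below k P → Below k′ P
below-mono []             k≤k′ p             = tt
below-mono (inc i ∷ P)    k≤k′ (i<k , p)     = <-≤-trans i<k k≤k′ , below-mono P k≤k′ p
below-mono (loop i B ∷ P) k≤k′ (i<k , b , p) =
  <-≤-trans i<k k≤k′ , below-mono B k≤k′ b , below-mono P k≤k′ p

below-exists : ∀ P → ∃ λ k → Below k P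
below-exists []          = 0 , tt
below-exists (inc i ∷ P) with below-exists P
... | k , p = suc i + k , m≤m+n (suc i) k , below-mono P (m≤n+m k (suc i)) p
below-exists (loop i B ∷ P) with below-exists B | below-exists P
... | k , b | k′ , p = suc i + (k + k′) , m≤m+n (suc i) (k + k′) ,
  below-mono B (≤-trans (m≤m+n k k′) (m≤n+m (k + k′) (suc i))) b ,
  below-mono P (≤-trans (m≤n+m k′ k) (m≤n+m (k + k′) (suc i))) p

data Bounded (k m : ℕ) : Instr → Set where
  inc : ∀ {i t} → i < k → t < m → Bounded k m (inc i t)
  jz  : ∀ {i z t} → i < k → z < m → t < m → Bounded k m (jz i z t)
  jmp : ∀ {t} → t < m → Bounded k m (jmp t)
  acc : Bounded k m acc

assemble-bounded : ∀ {k m} P l → Below k P → l + width P < m → All (Bounded k m) (assemble P l)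
assemble-bounded [] l r b = []
assemble-bounded {k} {m} (inc i ∷ P) l r b =
  inc (proj₁ r) (≤-<-trans (m≤m+n (suc l) (width P)) b′) ∷
  assemble-bounded P (suc l) (proj₂ r) b′
  where
  b′ : suc l + width P < m
  b′ = ≡-subst (_< m) (+-suc l (width P)) b
assemble-bounded {k} {m} (loop i B ∷ P) l r b =
  jz (proj₁ r) e<m (≤-<-trans (s≤s (m≤m+n l _)) (<-trans (n<1+n _) e<m)) ∷
  Allₚ.++⁺ (assemble-bounded B (suc l) (proj₁ (proj₂ r)) (<-trans (n<1+n _) e<m))
    (jmp (≤-<-trans (m≤m+n l _) b) ∷ assemble-bounded P _ (proj₂ (proj₂ r)) b′)
  where
  e : ℕ
  e = 2 + (l + width B)
  b′ : e + width P < m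
  b′ = ≡-subst (_< m) eq b
    where
    open ≡-Reasoning
    eq : l + suc (width B + suc (width P)) ≡ e + width P
    eq = begin
      l + suc (width B + suc (width P))  ≡⟨ +-suc l _ ⟩
      suc (l + (width B + suc (width P))) ≡⟨ cong suc (sym (+-assoc l (width B) _)) ⟩
      suc (l + width B + suc (width P))  ≡⟨ cong suc (+-suc (l + width B) _) ⟩
      e + width P ∎
  e<m : e < m
  e<m = ≤-<-trans (m≤m+n e (width P)) b′

-- Machine runs and the simulation of programs

module Machine (k : ℕ) (I : ℕ → Instr) where

  Conf : Set
  Conf = ℕ × Vec ℕ k

  -- The tested value is an argument of its own, so that an equation for `get i v` can be used by
  -- `cong`.
  branch : ℕ → ℕ → ℕ → Vec ℕ k → ℕ → Conf
  branch i z t v zero    = z , v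
  branch i z t v (suc _) = t , modify i pred v

  exec : Instr → Conf → Conf
  exec (inc i t)  (l , v) = t , modify i suc v
  exec (jz i z t) (l , v) = branch i z t v (get i v)
  exec (jmp t)    (l , v) = t , v
  exec acc        (l , v) = l , v

  step : Conf → Conf
  step c = exec (I (proj₁ c)) c

  data _↠_ : Conf → Conf → Set where
    stop : ∀ {c} → c ↠ c
    next : ∀ {c c′} → step c ↠ c′ → c ↠ c′

  ↠-trans : ∀ {c c′ c″} → c ↠ c′ → c′ ↠ c″ → c ↠ c″
  ↠-trans stop     s = s
  ↠-trans (next r) s = next (↠-trans r s)

  ↠-step : ∀ {l v ins c c′} → I l ≡ ins → exec ins (l , v) ≡ c → c ↠ c′ → (l , v) ↠ c′
  ↠-step refl refl r = next r

  Segment : ℕ → List Instr → Set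
  Segment l []         = ⊤
  Segment l (ins ∷ is) = I l ≡ ins × Segment (suc l) is

  segment-++ˡ : ∀ l is {js} → Segment l (is ++ js) → Segment l is
  segment-++ˡ l []       s       = tt
  segment-++ˡ l (_ ∷ is) (e , s) = e , segment-++ˡ (suc l) is s

  segment-++ʳ : ∀ l is {js} → Segment l (is ++ js) → Segment (l + length is) js
  segment-++ʳ l []       {js} s       = ≡-subst (λ m → Segment m js) (sym (+-identityʳ l)) s
  segment-++ʳ l (_ ∷ is) {js} (e , s) =
    ≡-subst (λ m → Segment m js) (sym (+-suc l (length is))) (segment-++ʳ (suc l) is s)

  -- A test of a register outside the vector would see the default 0 of `get` instead of the
  -- program's register.
  module _ (regs-bounded : ∀ {l i z t} → I l ≡ jz i z t → i < k) where

    simulate : ∀ {P σ τ} l → P ⊢ σ ⇒ τ → Segment l (assemble P l) →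
      (l , restrict k σ) ↠ (l + width P , restrict k τ)
    simulate l done s rewrite +-identityʳ l = stop
    simulate {inc i ∷ P} {σ} l (inc d) (e , s) rewrite +-suc l (width P) =
      ↠-step e (cong (suc l ,_) (sym (restrict-update k i _ suc σ refl))) (simulate (suc l) d s)
    simulate {loop i B ∷ P} {σ} {τ} l (exit z d) (e , s) =
      ↠-step {c = 2 + (l + width B) , restrict k σ} e
        (cong (branch i _ _ _) (trans (get-restrict i σ (regs-bounded e)) z))
        (≡-subst (λ m → (2 + (l + width B) , restrict k σ) ↠ (m , restrict k τ)) (sym (end l B P))
          (simulate _ d (proj₂ (tail l B P s))))
      where
      end : ∀ l B P → l + suc (width B + suc (width P)) ≡ 2 + (l + width B) + width P
      end l B P = trans (+-suc l _) (cong suc (trans (sym (+-assoc l (width B) _)) (+-suc _ _)))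
      tail : ∀ l B P → Segment (suc l) (assemble B (suc l) ++ jmp l ∷ assemble P (2 + (l + width B))) →
        Segment (suc (l + width B)) (jmp l ∷ assemble P (2 + (l + width B)))
      tail l B P s = ≡-subst (λ m → Segment (suc (l + m)) (jmp l ∷ assemble P (2 + (l + width B))))
        (length-assemble B (suc l)) (segment-++ʳ (suc l) (assemble B (suc l)) s)
    simulate {loop i B ∷ P} {σ} {τ} l (iter {τ = σ′} {n = n} z b d) (e , s) =
      ↠-step {c = suc l , restrict k (update i n σ)} e
        (trans (cong (branch i _ _ _) (trans (get-restrict i σ (regs-bounded e)) z))
               (cong (suc l ,_) (sym (restrict-update k i n pred σ (cong pred (sym z))))))
        (↠-trans (simulate (suc l) b (segment-++ˡ (suc l) (assemble B (suc l)) s))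
          (↠-step (proj₁ tail) refl (simulate l d (e , s))))
      where
      tail : Segment (suc (l + width B)) (jmp l ∷ assemble P (2 + (l + width B)))
      tail = ≡-subst (λ m → Segment (suc (l + m)) (jmp l ∷ assemble P (2 + (l + width B))))
        (length-assemble B (suc l)) (segment-++ʳ (suc l) (assemble B (suc l)) s)

  run : ℕ → Conf → Conf
  run zero    c = c
  run (suc n) c = run n (step c)

  Accepts : Conf → Set
  Accepts c = ∃ λ n → I (proj₁ (run n c)) ≡ acc

  step-acc : ∀ c → I (proj₁ c) ≡ acc → step c ≡ c
  step-acc c e rewrite e = refl

  -- An accepting configuration is a fixed point of `step`, so acceptance is not lost by moving on.
  -- Both directions are needed, since conversion uses the rules both ways.
  accepts-step : ∀ c → Accepts c ⇔ Accepts (step c)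
  accepts-step c = mk⇔ to λ (n , e) → suc n , e
    where
    to : Accepts c → Accepts (step c)
    to (zero  , e) = 0 , trans (cong (I ∘ proj₁) (step-acc c e)) e
    to (suc n , e) = n , e

  accepts-↠ : ∀ {c c′} → c ↠ c′ → Accepts c → Accepts c′
  accepts-↠ stop           a = a
  accepts-↠ (next {c} r) a = accepts-↠ r (Equivalence.to (accepts-step c) a)

  stuck-rejects : ∀ {l v} → I l ≡ jmp l → ¬ Accepts (l , v)
  stuck-rejects {l} {v} e (n , a) with trans (sym e) (trans (cong (I ∘ proj₁) (sym (fixed n))) a)
    where
    fixed : ∀ n → run n (l , v) ≡ (l , v)
    fixed zero    = refl
    fixed (suc n) = trans (cong (λ ins → run n (exec ins (l , v))) e) (fixed n)
  ... | ()

-- The rewrite system of a machine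

-- Labels are plain numbers, and clamping lets rules be written without bounds; these enter only
-- through `toℕ-clamp`.
clamp : ∀ n → ℕ → Fin (suc n)
clamp n       zero    = zero
clamp zero    (suc l) = zero
clamp (suc n) (suc l) = suc (clamp n l)

toℕ-clamp : ∀ {n l} → l ≤ n → toℕ (clamp n l) ≡ l
toℕ-clamp {n}     {zero}  _         = refl
toℕ-clamp {suc n} {suc l} (s≤s l≤n) = cong suc (toℕ-clamp l≤n)

clamp-toℕ : ∀ {n} (f : Fin (suc n)) → clamp n (toℕ f) ≡ f
clamp-toℕ {zero}  zero    = refl
clamp-toℕ {suc n} zero    = refl
clamp-toℕ {suc n} (suc f) = cong suc (clamp-toℕ f)

module MachineTRS (k m : ℕ) (I : ℕ → Instr) where

  open Machine k I

  arities : Fin (4 + suc m) → ℕ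
  arities zero                         = 0
  arities (suc zero)                   = 0
  arities (suc (suc zero))             = 0
  arities (suc (suc (suc zero)))       = 1
  arities (suc (suc (suc (suc _))))    = k

  F : Signature
  F = record { size = 4 + suc m ; arity = arities }

  T : Set
  T = Term F

  pattern A = fun zero []
  pattern B = fun (suc zero) []
  pattern 0̂ = fun (suc (suc zero)) []
  pattern ŝ t = fun (suc (suc (suc zero))) (t ∷ [])
  pattern state f ts = fun (suc (suc (suc (suc f)))) ts

  at : ℕ → Vec T k → T
  at l ts = state (clamp m l) ts

  variables : ℕ → ∀ n → Vec T n
  variables o zero    = []
  variables o (suc n) = var o ∷ variables (suc o) n

  xs : Vec T k
  xs = variables 0 k

  sucAt zeroAt : ℕ → ∀ {n} → Vec T n → Vec T n
  sucAt  i = modify i (λ t → ŝ t)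
  zeroAt i = modify i (λ _ → 0̂)

  stateRule : ℕ → Vec T k → T → Rule F
  stateRule l ts r = record { lhs = at l ts ; rhs = r ; lhs-nonvar = λ _ () }

  -- The last rule of jz makes every term containing the state reducible
  -- without changing the conversion relation.
  rulesOf : ℕ → Instr → List (Rule F)
  rulesOf l (inc i t)  = stateRule l xs (at t (sucAt i xs)) ∷ []
  rulesOf l (jz i z t) = stateRule l (zeroAt i xs) (at z (zeroAt i xs)) ∷
                         stateRule t xs (at l (sucAt i xs)) ∷
                         stateRule l xs (at l xs) ∷ []
  rulesOf l (jmp t)    = stateRule l xs (at t xs) ∷ []
  rulesOf l acc        = stateRule l xs B ∷ []

  numeralRules : List (Rule F)
  numeralRules = record { lhs = 0̂ ; rhs = 0̂ ; lhs-nonvar = λ _ () } ∷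
                 record { lhs = ŝ (var 0) ; rhs = ŝ (var 0) ; lhs-nonvar = λ _ () } ∷ []

  -- With the highest label in front, raising the bound leaves the earlier list as a tail, and its
  -- code as a subcode.
  rulesBelow : ℕ → List (Rule F)
  rulesBelow zero    = numeralRules
  rulesBelow (suc l) = rulesOf l (I l) ++ rulesBelow l

  zeros : ∀ n → Vec T n
  zeros n = Vec.replicate n 0̂

  -- The start rule has `A` on the right: as a left-hand side `A` would not be a normal form.
  system : TRS
  system = record { sig = F ; rules = stateRule m (zeros k) A ∷ rulesBelow (suc m) }

  all-below : ∀ {P : Rule F → Set} n → n ≤ suc m → All P numeralRules →
    (∀ l → l < suc m → All P (rulesOf l (I l))) → All P (rulesBelow n)
  all-below zero    _     base each = base
  all-below (suc n) n<1+m base each =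
    Allₚ.++⁺ (each n n<1+m) (all-below n (<⇒≤ n<1+m) base each)

  -- Linearity, flatness and height of the rules

  record Shape (ρ : Rule F) : Set where
    constructor shape
    field
      linear : Unique (vars (lhs ρ)) × Unique (vars (rhs ρ))
      flat   : Flat (lhs ρ)
      height≤2 : height (rhs ρ) ≤ 2

  Thin : (T → T) → Set
  Thin g = ∀ x → vars (g (var x)) ≡ [] ⊎ vars (g (var x)) ≡ x ∷ []

  variables-above : ∀ o n → All (o ≤_) (varsᵛ (variables o n))
  variables-above o zero    = []
  variables-above o (suc n) = ≤-refl ∷ All.map <⇒≤ (variables-above (suc o) n)

  variables-unique : ∀ o n → Unique (varsᵛ (variables o n))
  variables-unique o zero    = []
  variables-unique o (suc n) =
    All.map <⇒≢ (variables-above (suc o) n) ∷ variables-unique (suc o) n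

  modify-above : ∀ {g} → Thin g → ∀ i o n → All (o ≤_) (varsᵛ (modify i g (variables o n)))
  modify-above thin i       o zero = []
  modify-above {g} thin zero o (suc n) with vars (g (var o)) | thin o
  ... | _ | inj₁ refl = All.map <⇒≤ (variables-above (suc o) n)
  ... | _ | inj₂ refl = variables-above o (suc n)
  modify-above thin (suc i) o (suc n) = ≤-refl ∷ All.map <⇒≤ (modify-above thin i (suc o) n)

  modify-unique : ∀ {g} → Thin g → ∀ i o n → Unique (varsᵛ (modify i g (variables o n)))
  modify-unique thin i       o zero    = []
  modify-unique {g} thin zero o (suc n) with vars (g (var o)) | thin o
  ... | _ | inj₁ refl = variables-unique (suc o) n
  ... | _ | inj₂ refl = variables-unique o (suc n)
  modify-unique thin (suc i) o (suc n) =
    All.map <⇒≢ (modify-above thin i (suc o) n) ∷ modify-unique thin i (suc o) n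

  xs-unique : Unique (varsᵛ xs)
  xs-unique = variables-unique 0 k

  zeroAt-unique : ∀ i → Unique (varsᵛ (zeroAt i xs))
  zeroAt-unique i = modify-unique (λ _ → inj₁ refl) i 0 k

  sucAt-unique : ∀ i → Unique (varsᵛ (sucAt i xs))
  sucAt-unique i = modify-unique (λ _ → inj₂ refl) i 0 k

  zeros-unique : ∀ n → Unique (varsᵛ (zeros n))
  zeros-unique zero    = []
  zeros-unique (suc n) = zeros-unique n

  foldr-⊔-heights : ∀ {n d} (ts : Vec T n) → Allᵛ (λ t → height t ≤ d) ts →
    Vec.foldr′ _⊔_ 0 (heights ts) ≤ d
  foldr-⊔-heights []       []       = z≤n
  foldr-⊔-heights (t ∷ ts) (p ∷ ps) = ⊔-lub p (foldr-⊔-heights ts ps)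

  nodeHeight-≤ : ∀ {n d} (ts : Vec T n) → Allᵛ (λ t → height t ≤ d) ts →
    nodeHeight {F} (heights ts) ≤ suc d
  nodeHeight-≤ []       []       = z≤n
  nodeHeight-≤ (t ∷ ts) (p ∷ ps) = s≤s (foldr-⊔-heights (t ∷ ts) (p ∷ ps))

  heights-variables : ∀ {d} o n → Allᵛ (λ t → height t ≤ d) (variables o n)
  heights-variables o zero    = []
  heights-variables o (suc n) = z≤n ∷ heights-variables (suc o) n

  heights-modify : ∀ {g d} → (∀ x → height (g (var x)) ≤ d) → ∀ i o n →
    Allᵛ (λ t → height t ≤ d) (modify i g (variables o n))
  heights-modify h i       o zero    = []
  heights-modify h zero    o (suc n) = h o ∷ heights-variables (suc o) n
  heights-modify h (suc i) o (suc n) = z≤n ∷ heights-modify h i (suc o) n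

  heights-zeros : ∀ n → Allᵛ (λ t → height t ≤ 0) (zeros n)
  heights-zeros zero    = []
  heights-zeros (suc n) = z≤n ∷ heights-zeros n

  rulesOf-shape : ∀ l ins → All Shape (rulesOf l ins)
  rulesOf-shape l (inc i t) =
    shape (xs-unique , sucAt-unique i)
          (nodeHeight-≤ _ (heights-variables 0 k))
          (nodeHeight-≤ _ (heights-modify (λ _ → ≤-refl) i 0 k)) ∷ []
  rulesOf-shape l (jz i z t) =
    shape (zeroAt-unique i , zeroAt-unique i)
          (nodeHeight-≤ _ (heights-modify (λ _ → z≤n) i 0 k))
          (nodeHeight-≤ _ (heights-modify (λ _ → z≤n) i 0 k)) ∷
    shape (xs-unique , sucAt-unique i)
          (nodeHeight-≤ _ (heights-variables 0 k))
          (nodeHeight-≤ _ (heights-modify (λ _ → ≤-refl) i 0 k)) ∷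
    shape (xs-unique , xs-unique)
          (nodeHeight-≤ _ (heights-variables 0 k))
          (nodeHeight-≤ _ (heights-variables 0 k)) ∷ []
  rulesOf-shape l (jmp t) =
    shape (xs-unique , xs-unique)
          (nodeHeight-≤ _ (heights-variables 0 k))
          (nodeHeight-≤ _ (heights-variables 0 k)) ∷ []
  rulesOf-shape l acc =
    shape (xs-unique , []) (nodeHeight-≤ _ (heights-variables 0 k)) z≤n ∷ []

  system-shape : All Shape (rules system)
  system-shape =
    shape (zeros-unique k , []) (nodeHeight-≤ _ (heights-zeros k)) z≤n ∷
    all-below (suc m) ≤-refl
      (shape ([] , []) z≤n z≤n ∷ shape ([] ∷ [] , [] ∷ []) ≤-refl (s≤s z≤n) ∷ [])
      (λ l _ → rulesOf-shape l (I l))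

  system-linear : Linear system
  system-linear = All.map Shape.linear system-shape

  system-flat : LeftFlat system
  system-flat = All.map Shape.flat system-shape

  system-height≤2 : RightHeight≤ 2 system
  system-height≤2 = All.map Shape.height≤2 system-shape

  -- Machine steps as conversions

  infix 4 _~_
  _~_ : T → T → Set
  _~_ = EqClosure (Step system)

  substᵛ-modify : ∀ {n} (σ : ℕ → T) (g : T → T) → (∀ t → subst σ (g t) ≡ g (subst σ t)) →
    ∀ i (ts : Vec T n) → substᵛ σ (modify i g ts) ≡ modify i g (substᵛ σ ts)
  substᵛ-modify σ g e i       []       = refl
  substᵛ-modify σ g e zero    (t ∷ ts) = cong (_∷ _) (e t)
  substᵛ-modify σ g e (suc i) (t ∷ ts) = cong (_ ∷_) (substᵛ-modify σ g e i ts)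

  -- The substitution that matches the pattern `variables 0 n` against `ts`; the default concerns
  -- only variables outside the pattern.
  nth : ∀ {n} → Vec T n → ℕ → T
  nth []       x       = 0̂
  nth (t ∷ ts) zero    = t
  nth (t ∷ ts) (suc x) = nth ts x

  substᵛ-shift : ∀ (σ : ℕ → T) o n →
    substᵛ σ (variables (suc o) n) ≡ substᵛ (σ ∘ suc) (variables o n)
  substᵛ-shift σ o zero    = refl
  substᵛ-shift σ o (suc n) = cong (_ ∷_) (substᵛ-shift σ (suc o) n)

  substᵛ-nth : ∀ {n} (ts : Vec T n) → substᵛ (nth ts) (variables 0 n) ≡ ts
  substᵛ-nth []       = refl
  substᵛ-nth (t ∷ ts) = cong (t ∷_) (trans (substᵛ-shift (nth (t ∷ ts)) 0 _) (substᵛ-nth ts))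

  substᵛ-zeros : ∀ σ n → substᵛ σ (zeros n) ≡ zeros n
  substᵛ-zeros σ zero    = refl
  substᵛ-zeros σ (suc n) = cong (0̂ ∷_) (substᵛ-zeros σ n)

  numeral : ℕ → T
  numeral zero    = 0̂
  numeral (suc n) = ŝ (numeral n)

  numerals : ∀ {n} → Vec ℕ n → Vec T n
  numerals = Vec.map numeral

  numerals-modify : ∀ {n g ĝ} → (∀ x → numeral (g x) ≡ ĝ (numeral x)) →
    ∀ i (v : Vec ℕ n) → numerals (modify i g v) ≡ modify i ĝ (numerals v)
  numerals-modify e i       []      = refl
  numerals-modify e zero    (x ∷ v) = cong (_∷ _) (e x)
  numerals-modify e (suc i) (x ∷ v) = cong (_ ∷_) (numerals-modify e i v)

  ⌜_⌝ : Conf → T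
  ⌜ l , v ⌝ = at l (numerals v)

  rule-in : ∀ {ρ} l {n} → l < n → ρ ∈ rulesOf l (I l) → ρ ∈ rulesBelow n
  rule-in l {suc n} l<1+n ρ∈ with m≤n⇒m<n∨m≡n l<1+n
  ... | inj₁ (s≤s l<n) = ∈-++⁺ʳ (rulesOf n (I n)) (rule-in l l<n ρ∈)
  ... | inj₂ refl      = ∈-++⁺ˡ ρ∈

  convert : ∀ {ρ} l {ins} → l ≤ m → I l ≡ ins → ρ ∈ rulesOf l ins → ∀ σ →
    subst σ (lhs ρ) ~ subst σ (rhs ρ)
  convert l l≤m refl ρ∈ σ = Eq.return (root (there (rule-in l (s≤s l≤m) ρ∈)) σ)

  inst-suc : ∀ i (ts : Vec T k) → substᵛ (nth ts) (sucAt i xs) ≡ sucAt i ts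
  inst-suc i ts = trans (substᵛ-modify (nth ts) _ (λ _ → refl) i xs) (cong (sucAt i) (substᵛ-nth ts))

  inst-zero : ∀ i (ts : Vec T k) → substᵛ (nth ts) (zeroAt i xs) ≡ zeroAt i ts
  inst-zero i ts = trans (substᵛ-modify (nth ts) _ (λ _ → refl) i xs) (cong (zeroAt i) (substᵛ-nth ts))

  step-converts : ∀ l v → l ≤ m → ⌜ l , v ⌝ ~ ⌜ step (l , v) ⌝
  step-converts l v l≤m = go (I l) refl
    where
    ts : Vec T k
    ts = numerals v
    go : ∀ ins → I l ≡ ins → ⌜ l , v ⌝ ~ ⌜ exec ins (l , v) ⌝
    go (inc i t) e = subst₂ (λ us ws → at l us ~ at t ws) (substᵛ-nth ts)
      (trans (inst-suc i ts) (sym (numerals-modify (λ _ → refl) i v)))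
      (convert l l≤m e (here refl) (nth ts))
    go (jz i z t) e = jump (get i v) refl
      where
      jump : ∀ n → get i v ≡ n → ⌜ l , v ⌝ ~ ⌜ branch i z t v n ⌝
      -- Entry i is already zero, so putting zero there changes nothing and the pattern matches.
      jump zero g = ≡-subst (λ us → at l us ~ at z us) zeroed
        (convert l l≤m e (here refl) (nth ts))
        where
        zeroed : substᵛ (nth ts) (zeroAt i xs) ≡ ts
        zeroed = trans (inst-zero i ts) (trans (sym (numerals-modify (λ _ → refl) i v))
                   (cong numerals (modify-fixed i (const 0) v (sym g))))
      -- The rule leads from `t` back to `l`. It is instantiated with the decremented registers, and
      -- its right-hand side restores the original ones because entry i is positive.
      jump (suc n) g = Eq.symmetric _ (subst₂ (λ us ws → at t us ~ at l ws) (substᵛ-nth us) restored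
        (convert l l≤m e (there (here refl)) (nth us)))
        where
        us : Vec T k
        us = numerals (modify i pred v)
        restored : substᵛ (nth us) (sucAt i xs) ≡ ts
        restored = trans (inst-suc i us) (trans (sym (numerals-modify (λ _ → refl) i (modify i pred v)))
          (cong numerals (trans (modify-∘ i suc pred v)
            (modify-fixed i _ v (trans (cong (λ x → suc (pred x)) g) (sym g))))))
    go (jmp t) e = ≡-subst (λ us → at l us ~ at t us) (substᵛ-nth ts) (convert l l≤m e (here refl) (nth ts))
    go acc e = ε

  zeros-numerals : ∀ n → zeros n ≡ numerals (Vec.replicate n 0)
  zeros-numerals zero    = refl
  zeros-numerals (suc n) = cong (0̂ ∷_) (zeros-numerals n)

  A-converts : A ~ ⌜ m , Vec.replicate k 0 ⌝
  A-converts = ≡-subst (λ ts → A ~ at m ts)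
    (trans (substᵛ-zeros var k) (zeros-numerals k))
    (Eq.symmetric _ (Eq.return (root (here refl) var)))

  B-converts : ∀ {l v} → l ≤ m → I l ≡ acc → ⌜ l , v ⌝ ~ B
  B-converts {l} {v} l≤m e = ≡-subst (λ us → at l us ~ B) (substᵛ-nth (numerals v))
    (convert l l≤m e (here refl) (nth (numerals v)))

  module _ (bounded : ∀ l → l ≤ m → Bounded k (suc m) (I l)) where

    step-bounded : ∀ l v → l ≤ m → proj₁ (step (l , v)) ≤ m
    step-bounded l v l≤m with I l | bounded l l≤m
    ... | _ | inc _ (s≤s t≤m) = t≤m
    ... | _ | jz {i} _ (s≤s z≤m) (s≤s t≤m) with get i v
    ...   | zero  = z≤m
    ...   | suc _ = t≤m
    step-bounded l v l≤m | _ | jmp (s≤s t≤m) = t≤m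
    step-bounded l v l≤m | _ | acc = l≤m

    ↠-converts : ∀ {c c′} → c ↠ c′ → proj₁ c ≤ m → ⌜ c ⌝ ~ ⌜ c′ ⌝ × proj₁ c′ ≤ m
    ↠-converts stop     l≤m = ε , l≤m
    ↠-converts (next {l , v} r) l≤m with ↠-converts r (step-bounded l v l≤m)
    ... | conv , b = Eq.transitive _ (step-converts l v l≤m) conv , b

    general-rule : ∀ l ins → ∃ λ r → stateRule l xs r ∈ rulesOf l ins
    general-rule l (inc i t)  = _ , here refl
    general-rule l (jz i z t) = _ , there (there (here refl))
    general-rule l (jmp t)    = _ , here refl
    general-rule l acc        = _ , here refl

    state-reducible : ∀ f ts → ¬ IsNormalForm (Step system) (state f ts)
    state-reducible f ts nf with general-rule (toℕ f) (I (toℕ f))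
    ... | r , ρ∈ = nf (subst (nth ts) r , ≡-subst (λ t → Step system t (subst (nth ts) r))
      (cong₂ (λ g us → state g us) (clamp-toℕ f) (substᵛ-nth ts))
      (root (there (rule-in (toℕ f) (toℕ<n f) ρ∈)) (nth ts)))

    -- Symbols 0 and 1 are `A` and `B`, so no left-hand side is rooted in either.
    Headed : Rule F → Set
    Headed ρ = ∃ λ f → ∃ λ ts → lhs ρ ≡ fun (suc (suc f)) ts

    rulesOf-headed : ∀ l ins → All Headed (rulesOf l ins)
    rulesOf-headed l (inc i t)  = (_ , _ , refl) ∷ []
    rulesOf-headed l (jz i z t) = (_ , _ , refl) ∷ (_ , _ , refl) ∷ (_ , _ , refl) ∷ []
    rulesOf-headed l (jmp t)    = (_ , _ , refl) ∷ []
    rulesOf-headed l acc        = (_ , _ , refl) ∷ []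

    system-headed : All Headed (rules system)
    system-headed = (_ , _ , refl) ∷ all-below (suc m) ≤-refl
      ((_ , _ , refl) ∷ (_ , _ , refl) ∷ []) (λ l _ → rulesOf-headed l (I l))

    step-source : ∀ {t u} → Step system t u → t ≢ A × t ≢ B
    step-source (root ρ∈ σ) with All.lookup system-headed ρ∈
    ... | _ , _ , e rewrite e = (λ ()) , (λ ())
    step-source (arg zero             ts () st)
    step-source (arg (suc zero)       ts () st)
    step-source (arg (suc (suc f))    ts i  st) = (λ ()) , (λ ())

    accepts⇒¬UN : ∀ {l v} → (m , Vec.replicate k 0) ↠ (l , v) → I l ≡ acc → ¬ UN⁼ system
    accepts⇒¬UN {l} {v} r e un with ↠-converts r ≤-refl
    ... | conv , l≤m = un (A , B ,
      (λ (_ , st) → proj₁ (step-source st) refl) , (λ (_ , st) → proj₂ (step-source st) refl) ,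
      (λ ()) ,
      Eq.transitive _ A-converts (Eq.transitive _ conv (B-converts l≤m e)))

    -- An interpretation invariant under conversion

    mutual
      -- Arguments of a state can be arbitrary terms, so every term gets a number. Start and
      -- accepting rules link states with `A` and `B`, which therefore all share the value 0.
      value : (ℕ → ℕ) → T → ℕ
      value ρ (var x) = ρ x
      value ρ A       = 0
      value ρ B       = 0
      value ρ 0̂       = 0
      value ρ (ŝ t)   = suc (value ρ t)
      value ρ (state f ts) = 0

      values : ∀ {n} → (ℕ → ℕ) → Vec T n → Vec ℕ n
      values ρ []       = []
      values ρ (t ∷ ts) = value ρ t ∷ values ρ ts

    -- `B` is true because accepting states rewrite to it, and `A` is false because the start
    -- configuration is assumed to reject.
    Truth : (ℕ → ℕ) → T → Set
    Truth ρ (state f ts) = Accepts (toℕ f , values ρ ts)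
    Truth ρ B            = ⊤
    Truth ρ _            = ⊥

    Agree : (ℕ → ℕ) → T → T → Set
    Agree ρ t u = value ρ t ≡ value ρ u × Truth ρ t ⇔ Truth ρ u

    values-modify : ∀ {n ρ g ĝ} → (∀ t → value ρ (ĝ t) ≡ g (value ρ t)) →
      ∀ i (ts : Vec T n) → values ρ (modify i ĝ ts) ≡ modify i g (values ρ ts)
    values-modify e i       []       = refl
    values-modify e zero    (t ∷ ts) = cong (_∷ _) (e t)
    values-modify e (suc i) (t ∷ ts) = cong (_ ∷_) (values-modify e i ts)

    values-zeros : ∀ ρ n → values ρ (zeros n) ≡ Vec.replicate n 0
    values-zeros ρ zero    = refl
    values-zeros ρ (suc n) = cong (0 ∷_) (values-zeros ρ n)

    values-[]≔ : ∀ {n ρ u} (ts : Vec T n) i → value ρ (Vec.lookup ts i) ≡ value ρ u →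
      values ρ (ts [ i ]≔ u) ≡ values ρ ts
    values-[]≔ (t ∷ ts) zero    e = cong (_∷ _) (sym e)
    values-[]≔ (t ∷ ts) (suc i) e = cong (_ ∷_) (values-[]≔ ts i e)

    module _ (rejects : ¬ Accepts (m , Vec.replicate k 0)) (ρ : ℕ → ℕ) where

      Sound : Rule F → Set
      Sound r = ∀ σ → Agree ρ (subst σ (lhs r)) (subst σ (rhs r))

      truth-at : ∀ {l ts v} → l ≤ m → values ρ ts ≡ v → Truth ρ (at l ts) ≡ Accepts (l , v)
      truth-at l≤m refl = cong (λ l → Accepts (l , _)) (toℕ-clamp l≤m)

      at-agree : ∀ {l t ts us v w} → l ≤ m → t ≤ m → values ρ ts ≡ v → values ρ us ≡ w →
        Accepts (l , v) ⇔ Accepts (t , w) → Agree ρ (at l ts) (at t us)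
      at-agree l≤m t≤m e e′ a =
        refl , subst₂ _⇔_ (sym (truth-at l≤m e)) (sym (truth-at t≤m e′)) a

      accepts-exec : ∀ {l ins v c} → I l ≡ ins → exec ins (l , v) ≡ c →
        Accepts (l , v) ⇔ Accepts c
      accepts-exec {l} {v = v} refl refl = accepts-step (l , v)

      values-suc : ∀ σ i → values ρ (substᵛ σ (sucAt i xs)) ≡ modify i suc (values ρ (substᵛ σ xs))
      values-suc σ i = trans (cong (values ρ) (substᵛ-modify σ _ (λ _ → refl) i xs))
                             (values-modify (λ _ → refl) i (substᵛ σ xs))

      values-zero : ∀ σ i →
        values ρ (substᵛ σ (zeroAt i xs)) ≡ modify i (const 0) (values ρ (substᵛ σ xs))
      values-zero σ i = trans (cong (values ρ) (substᵛ-modify σ _ (λ _ → refl) i xs))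
                              (values-modify (λ _ → refl) i (substᵛ σ xs))

      rulesOf-sound : ∀ l ins → l ≤ m → I l ≡ ins → Bounded k (suc m) ins →
        All Sound (rulesOf l ins)
      rulesOf-sound l (inc i t) l≤m e (inc _ (s≤s t≤m)) =
        (λ σ → at-agree l≤m t≤m refl (values-suc σ i) (accepts-exec e refl)) ∷ []
      rulesOf-sound l (jz i z t) l≤m e (jz i<k (s≤s z≤m) (s≤s t≤m)) =
        (λ σ → at-agree l≤m z≤m (values-zero σ i) (values-zero σ i)
                 (accepts-exec e (cong (branch i z t _) (get-modify-0 i (values ρ (substᵛ σ xs)))))) ∷
        -- This rule is a machine step read from right to left: register i on the right is a
        -- successor, so the test at `l` decrements it and leads to the left-hand side.
        (λ σ → at-agree t≤m l≤m refl (values-suc σ i)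
                 (⇔-sym (accepts-exec e (trans
                   (cong (branch i z t _) (get-modify i suc (values ρ (substᵛ σ xs)) i<k))
                   (cong (t ,_) (trans (modify-∘ i pred suc _) (modify-id i _))))))) ∷
        (λ σ → refl , ⇔-id _) ∷ []
      rulesOf-sound l (jmp t) l≤m e (jmp (s≤s t≤m)) =
        (λ σ → at-agree l≤m t≤m refl refl (accepts-exec e refl)) ∷ []
      rulesOf-sound l acc l≤m e acc =
        (λ σ → refl , mk⇔ (λ _ → tt)
          (λ _ → ≡-subst (λ S → S) (sym (truth-at l≤m refl)) (0 , e))) ∷ []

      system-sound : All Sound (rules system)
      system-sound =
        (λ σ → refl , mk⇔ (λ a → rejects (≡-subst (λ S → S) (truth-at ≤-refl
          (trans (cong (values ρ) (substᵛ-zeros σ k)) (values-zeros ρ k))) a)) ⊥-elim) ∷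
        all-below (suc m) ≤-refl ((λ σ → refl , ⇔-id _) ∷ (λ σ → refl , ⇔-id _) ∷ [])
          (λ { l (s≤s l≤m) → rulesOf-sound l (I l) l≤m refl (bounded l l≤m) })

      -- The meaning of a state depends only on the values of its arguments, so invariance of
      -- `value` carries agreement through contexts.
      step-agree : ∀ {t u} → Step system t u → Agree ρ t u
      step-agree (root ρ∈ σ) = All.lookup system-sound ρ∈ σ
      step-agree (arg zero                   ts () st)
      step-agree (arg (suc zero)             ts () st)
      step-agree (arg (suc (suc zero))       ts () st)
      step-agree (arg (suc (suc (suc zero))) (t ∷ []) zero st) =
        cong suc (proj₁ (step-agree st)) , ⇔-id _
      step-agree (arg (suc (suc (suc (suc f)))) ts i st) =
        refl , ≡-subst (λ v → Accepts (toℕ f , values ρ ts) ⇔ Accepts (toℕ f , v))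
                 (sym (values-[]≔ ts i (proj₁ (step-agree st)))) (⇔-id _)

      ~-agree : ∀ {t u} → t ~ u → Agree ρ t u
      ~-agree ε = refl , ⇔-id _
      ~-agree (fwd st ◅ c) with step-agree st | ~-agree c
      ... | e , a | e′ , a′ = trans e e′ , (a′ ⇔-∘ a)
      ~-agree (bwd st ◅ c) with step-agree st | ~-agree c
      ... | e , a | e′ , a′ = trans (sym e) e′ , (a′ ⇔-∘ ⇔-sym a)

    -- Normal forms of the system

    base : ∀ n {ρ} → ρ ∈ numeralRules → ρ ∈ rulesBelow n
    base zero    ρ∈ = ρ∈
    base (suc n) ρ∈ = ∈-++⁺ʳ (rulesOf n (I n)) (base n ρ∈)

    data Irreducible : T → Set where
      isVar : ∀ x → Irreducible (var x)
      isA   : Irreducible A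
      isB   : Irreducible B

    normal⇒irreducible : ∀ t → IsNormalForm (Step system) t → Irreducible t
    normal⇒irreducible (var x) nf = isVar x
    normal⇒irreducible A nf = isA
    normal⇒irreducible B nf = isB
    normal⇒irreducible 0̂ nf = ⊥-elim (nf (_ , root (there (base (suc m) (here refl))) var))
    normal⇒irreducible (ŝ t) nf =
      ⊥-elim (nf (_ , root (there (base (suc m) (there (here refl)))) (const t)))
    normal⇒irreducible (state f ts) nf = ⊥-elim (state-reducible f ts nf)

    rejects⇒UN : ¬ Accepts (m , Vec.replicate k 0) → UN⁼ system
    rejects⇒UN rejects (M , N , nfM , nfN , M≢N , c) =
      separate (normal⇒irreducible M nfM) (normal⇒irreducible N nfN) M≢N c
      where
      agree : ∀ {t u} ρ → t ~ u → Agree ρ t u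
      agree ρ = ~-agree rejects ρ
      separate : ∀ {t u} → Irreducible t → Irreducible u → t ≢ u → ¬ (t ~ u)
      -- The identity valuation tells variables apart; the constant valuation 1 below tells them
      -- from `A` and `B`, whose value is 0. Only `A` against `B` needs `Truth`.
      separate (isVar x) (isVar y) t≢u c = t≢u (cong var (proj₁ (agree (λ x → x) c)))
      separate (isVar x) isA       t≢u c with proj₁ (agree (const 1) c)
      ... | ()
      separate (isVar x) isB       t≢u c with proj₁ (agree (const 1) c)
      ... | ()
      separate isA       (isVar y) t≢u c with proj₁ (agree (const 1) c)
      ... | ()
      separate isB       (isVar y) t≢u c with proj₁ (agree (const 1) c)
      ... | ()
      separate isA       isA       t≢u c = t≢u refl
      separate isB       isB       t≢u c = t≢u refl
      separate isA       isB       t≢u c = Equivalence.from (proj₂ (agree (const 0) c)) tt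
      separate isB       isA       t≢u c = Equivalence.to (proj₂ (agree (const 0) c)) tt

-- Codes of the systems

opaque
  listCode : ∀ {n} → Vec ℕ n → ℕ
  listCode cs = codeList (Vec.toList cs)

variableCodes : ℕ → ∀ n → Vec ℕ n
variableCodes o zero    = []
variableCodes o (suc n) = pair 0 o ∷ variableCodes (suc o) n

-- `codeTerm` marks a symbol by one plus its index: 1 and 2 for `A` and `B`, 3 and 4 for zero and
-- successor, `5 + l` for the state `l`.
zeroCode : ℕ
zeroCode = pair 3 0

sucCode : ℕ → ℕ
sucCode c = pair 4 (codeList (c ∷ []))

stateCode : ℕ → ℕ → ℕ
stateCode l c = pair (5 + l) c

-- Opaque, because Cantor pairings of numerals explode when conversion checking
-- unfolds them.
opaque
  consCode : ℕ → ℕ → ℕ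
  consCode c cs = suc (pair c cs)

  chainRuleCode : ℕ → ℕ → ℕ → ℕ
  chainRuleCode v v₀ l = pair (stateCode (suc l) v) (stateCode l v₀)

-- r, m, z and c are the codes of the arities of the states, the initial
-- state, its arguments and all rules but the initial one.
opaque
  systemCode : ℕ → ℕ → ℕ → ℕ → ℕ
  systemCode r m z c =
    pair (consCode 0 (consCode 0 (consCode 0 (consCode 1 r))))
         (consCode (pair (stateCode m z) (pair 1 0)) c)

repeatCode : ℕ → ℕ → ℕ
repeatCode c zero    = 0
repeatCode c (suc n) = consCode c (repeatCode c n)

opaque
  unfolding consCode

  codeList-tabulate : ∀ c n → codeList (List.tabulate {n = n} (const c)) ≡ repeatCode c n
  codeList-tabulate c zero    = refl
  codeList-tabulate c (suc n) = cong (consCode c) (codeList-tabulate c n)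

-- The codes are computed from labels alone, before the largest label m is chosen, so one list of
-- codes serves all truncations.
module RuleCodes (k : ℕ) (I : ℕ → Instr) where

  variablesCode : ℕ
  variablesCode = listCode (variableCodes 0 k)

  sucAtCode zeroAtCode : ℕ → ℕ
  sucAtCode  i = listCode (modify i sucCode (variableCodes 0 k))
  zeroAtCode i = listCode (modify i (const zeroCode) (variableCodes 0 k))

  instrCodes : ℕ → Instr → List ℕ
  instrCodes l (inc i t)  = pair (stateCode l variablesCode) (stateCode t (sucAtCode i)) ∷ []
  instrCodes l (jz i z t) =
    pair (stateCode l (zeroAtCode i)) (stateCode z (zeroAtCode i)) ∷
    pair (stateCode t variablesCode) (stateCode l (sucAtCode i)) ∷
    pair (stateCode l variablesCode) (stateCode l variablesCode) ∷ []
  instrCodes l (jmp t)    = pair (stateCode l variablesCode) (stateCode t variablesCode) ∷ []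
  instrCodes l acc        = pair (stateCode l variablesCode) (pair 2 0) ∷ []

  codesBelow : ℕ → List ℕ
  codesBelow zero    = pair zeroCode zeroCode ∷ pair (sucCode (pair 0 0)) (sucCode (pair 0 0)) ∷ []
  codesBelow (suc l) = instrCodes l (I l) ++ codesBelow l

  module _ (m : ℕ) where

    open MachineTRS k m I

    code-at : ∀ {l ts c} → l ≤ m → codeList (codeTerms ts) ≡ c → codeTerm (at l ts) ≡ stateCode l c
    code-at l≤m e = cong₂ (λ l c → pair (5 + l) c) (toℕ-clamp l≤m) e

    codeTerms-variables : ∀ o n → codeTerms (variables o n) ≡ Vec.toList (variableCodes o n)
    codeTerms-variables o zero    = refl
    codeTerms-variables o (suc n) = cong (pair 0 o ∷_) (codeTerms-variables (suc o) n)

    codeTerms-modify : ∀ {g : T → T} {h : ℕ → ℕ} → (∀ t → codeTerm (g t) ≡ h (codeTerm t)) →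
      ∀ i o n → codeTerms (modify i g (variables o n)) ≡ Vec.toList (modify i h (variableCodes o n))
    codeTerms-modify e i       o zero    = refl
    codeTerms-modify e zero    o (suc n) = cong₂ _∷_ (e (var o)) (codeTerms-variables (suc o) n)
    codeTerms-modify e (suc i) o (suc n) = cong (pair 0 o ∷_) (codeTerms-modify e i (suc o) n)

    codeTerms-zeros : ∀ n → codeTerms (zeros n) ≡ Vec.toList (Vec.replicate n zeroCode)
    codeTerms-zeros zero    = refl
    codeTerms-zeros (suc n) = cong (zeroCode ∷_) (codeTerms-zeros n)

    opaque
      unfolding listCode

      code-xs : ∀ {l} → l ≤ m → codeTerm (at l xs) ≡ stateCode l variablesCode
      code-xs l≤m = code-at {ts = xs} l≤m (cong codeList (codeTerms-variables 0 k))

      code-suc : ∀ {l} i → l ≤ m → codeTerm (at l (sucAt i xs)) ≡ stateCode l (sucAtCode i)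
      code-suc i l≤m = code-at {ts = sucAt i xs} l≤m
        (cong codeList (codeTerms-modify {h = sucCode} (λ _ → refl) i 0 k))

      code-zero : ∀ {l} i → l ≤ m → codeTerm (at l (zeroAt i xs)) ≡ stateCode l (zeroAtCode i)
      code-zero i l≤m = code-at {ts = zeroAt i xs} l≤m
        (cong codeList (codeTerms-modify {h = const zeroCode} (λ _ → refl) i 0 k))

    rulesOf-codes : ∀ l ins → l ≤ m → Bounded k (suc m) ins →
      List.map codeRule (rulesOf l ins) ≡ instrCodes l ins
    rulesOf-codes l (inc i t) l≤m (inc _ (s≤s t≤m)) =
      cong (_∷ []) (cong₂ pair (code-xs l≤m) (code-suc i t≤m))
    rulesOf-codes l (jz i z t) l≤m (jz _ (s≤s z≤m) (s≤s t≤m)) =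
      cong₂ _∷_ (cong₂ pair (code-zero i l≤m) (code-zero i z≤m))
        (cong₂ _∷_ (cong₂ pair (code-xs t≤m) (code-suc i l≤m))
          (cong (_∷ []) (cong₂ pair (code-xs l≤m) (code-xs l≤m))))
    rulesOf-codes l (jmp t) l≤m (jmp (s≤s t≤m)) =
      cong (_∷ []) (cong₂ pair (code-xs l≤m) (code-xs t≤m))
    rulesOf-codes l acc l≤m acc = cong (_∷ []) (cong₂ pair (code-xs l≤m) refl)

    module _ (bounded : ∀ l → l ≤ m → Bounded k (suc m) (I l)) where

      rulesBelow-codes : ∀ n → n ≤ suc m → List.map codeRule (rulesBelow n) ≡ codesBelow n
      rulesBelow-codes zero    _         = refl
      rulesBelow-codes (suc l) (s≤s l≤m) =
        trans (map-++ codeRule (rulesOf l (I l)) (rulesBelow l))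
          (cong₂ _++_ (rulesOf-codes l (I l) l≤m (bounded l l≤m))
                      (rulesBelow-codes l (m≤n⇒m≤1+n l≤m)))

      opaque
        unfolding consCode listCode systemCode

        code-system : code system ≡
          systemCode (repeatCode k (suc m)) m (listCode (Vec.replicate k zeroCode))
                       (codeList (codesBelow (suc m)))
        code-system = cong₂ (λ r c → pair (consCode 0 (consCode 0 (consCode 0 (consCode 1 r)))) c)
            (codeList-tabulate k (suc m))
            (cong₂ consCode
              (cong₂ pair (code-at {ts = zeros k} ≤-refl (cong codeList (codeTerms-zeros k))) refl)
              (cong codeList (rulesBelow-codes (suc m) ≤-refl)))

-- The machine has infinitely many labels: those beyond the fixed program form a
-- chain that increments register 0 at each step down to the program, so that the
-- distance at which the chain is entered is the input.  A TRS takes a finite part.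
fetch : List Instr → Instr → ℕ → Instr
fetch []         ins l       = ins
fetch (x ∷ is)   ins zero    = x
fetch (x ∷ is)   ins (suc l) = fetch is ins l

fetch-default : ∀ is {ins l} → length is ≤ l → fetch is ins l ≡ ins
fetch-default []       _         = refl
fetch-default (x ∷ is) (s≤s n≤l) = fetch-default is n≤l

fetch-all : ∀ {P : Instr → Set} {is ins} → All P is → P ins → ∀ l → P (fetch is ins l)
fetch-all []       q l       = q
fetch-all (p ∷ ps) q zero    = p
fetch-all (p ∷ ps) q (suc l) = fetch-all ps q l

fetch-++ : ∀ is {x js ins} → fetch (is ++ x ∷ js) ins (length is) ≡ x
fetch-++ []       = refl
fetch-++ (_ ∷ is) = fetch-++ is

input : ℕ → State
input n zero    = n
input n (suc _) = 0

restrict-input : ∀ k → restrict k (input 0) ≡ Vec.replicate k 0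
restrict-input zero    = refl
restrict-input (suc k) = cong (0 ∷_) (restrict-0 k)
  where
  restrict-0 : ∀ k → restrict k (const 0) ≡ Vec.replicate k 0
  restrict-0 zero    = refl
  restrict-0 (suc k) = cong (0 ∷_) (restrict-0 k)

module Layout (k₀ : ℕ) (P : Prog) (out : ℕ) (out<k : out < suc k₀) (below : Below (suc k₀) P) where

  k S top : ℕ
  k = suc k₀
  S = width P
  top = 3 + S

  -- A nonzero result leads to acceptance at `1 + S`, the result 0 to the endless loop at `2 + S`.
  -- The last instruction, at `top`, is the exit of the chain into the program.
  epilogue fixed : List Instr
  epilogue = jz out (2 + S) (1 + S) ∷ acc ∷ jmp (2 + S) ∷ jmp 0 ∷ []
  fixed    = assemble P 0 ++ epilogue

  length-fixed : length fixed ≡ suc top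
  length-fixed = trans (length-++ (assemble P 0))
    (trans (cong (_+ 4) (length-assemble P 0)) (+-comm S 4))

  I : ℕ → Instr
  I l = fetch fixed (inc 0 (pred l)) l

  I-chain : ∀ j → I (suc (j + top)) ≡ inc 0 (j + top)
  I-chain j = fetch-default fixed (≤-trans (≤-reflexive length-fixed) (s≤s (m≤n+m top j)))

  bounded : ∀ m → top ≤ m → ∀ l → l ≤ m → Bounded k (suc m) (I l)
  bounded m top≤m l l≤m = fetch-all
    (Allₚ.++⁺ (assemble-bounded P 0 below (s≤s (S+≤m 0 z≤n)))
      (jz out<k (s≤s (S+≤m 2 (s≤s (s≤s z≤n)))) (s≤s (S+≤m 1 (s≤s z≤n))) ∷ acc ∷
       jmp (s≤s (S+≤m 2 (s≤s (s≤s z≤n)))) ∷ jmp z<s ∷ []))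
    (inc z<s (s≤s (≤-trans pred[n]≤n l≤m))) l
    where
    S+≤m : ∀ j → j ≤ 3 → j + S ≤ m
    S+≤m j j≤3 = ≤-trans (+-monoˡ-≤ S j≤3) top≤m

  open Machine k I

  regs-bounded : ∀ {l i z t} → I l ≡ jz i z t → i < k
  regs-bounded {l} e with I l | bounded (l + top) (m≤n+m top l) l (m≤m+n l top)
  regs-bounded refl | _ | jz i<k _ _ = i<k

  segment : ∀ is js → fixed ≡ is ++ js → Segment (length is) js
  segment is []       e = tt
  segment is (x ∷ js) e =
    trans (cong (λ xs → fetch xs (inc 0 (pred (length is))) (length is)) e) (fetch-++ is) ,
    ≡-subst (λ l → Segment l js) (trans (length-++ is) (+-comm (length is) 1))
      (segment (is ++ x ∷ []) js (trans e (sym (++-assoc is (x ∷ []) js))))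

  code-segment : Segment 0 (assemble P 0)
  code-segment = segment-++ˡ 0 (assemble P 0) (segment [] fixed refl)

  epilogue-segment : Segment S epilogue
  epilogue-segment = ≡-subst (λ l → Segment l epilogue) (length-assemble P 0)
    (segment-++ʳ 0 (assemble P 0) (segment [] fixed refl))

  chain : ∀ j i → (j + top , restrict k (input i)) ↠ (0 , restrict k (input (j + i)))
  chain zero    i = ↠-step (proj₁ (proj₂ (proj₂ (proj₂ epilogue-segment)))) refl stop
  chain (suc j) i = ↠-step (I-chain j) refl
    (≡-subst (λ n → (j + top , restrict k (input (suc i))) ↠ (0 , restrict k (input n)))
             (+-suc j i) (chain j (suc i)))

  module _ (b : ℕ) where

    open MachineTRS k (b + top) I

    start : ℕ × Vec ℕ k
    start = b + top , Vec.replicate k 0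

    start-runs : ∀ {τ c} → P ⊢ input b ⇒ τ → (S , restrict k τ) ↠ c → start ↠ c
    start-runs {τ} {c} d r =
      ≡-subst (λ v → (b + top , v) ↠ c) (restrict-input k)
        (↠-trans (≡-subst (λ n → (b + top , restrict k (input 0)) ↠ (0 , restrict k (input n)))
                          (+-identityʳ b) (chain b 0))
          (↠-trans (simulate regs-bounded 0 d code-segment) r))

    truncation-bounded : ∀ l → l ≤ b + top → Bounded k (suc (b + top)) (I l)
    truncation-bounded = bounded (b + top) (m≤n+m top b)

    opaque
      truncation : TRS
      truncation = system

      truncation-linear : Linear truncation
      truncation-linear = system-linear

      truncation-flat : LeftFlat truncation
      truncation-flat = system-flat

      truncation-height≤2 : RightHeight≤ 2 truncation
      truncation-height≤2 = system-height≤2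

      returns-suc : ∀ {τ n} → P ⊢ input b ⇒ τ → τ out ≡ suc n → ¬ UN⁼ truncation
      returns-suc {τ} d e = accepts⇒¬UN truncation-bounded
        (start-runs d (↠-step (proj₁ epilogue-segment)
          (cong (branch out _ _ _) (trans (get-restrict out τ out<k) e)) stop))
        (proj₁ (proj₂ epilogue-segment))

      returns-zero : ∀ {τ} → P ⊢ input b ⇒ τ → τ out ≡ 0 → UN⁼ truncation
      returns-zero {τ} d e = rejects⇒UN truncation-bounded λ accepts →
        stuck-rejects (proj₁ (proj₂ (proj₂ epilogue-segment)))
          (accepts-↠ (start-runs d (↠-step (proj₁ epilogue-segment)
            (cong (branch out _ _ _) (trans (get-restrict out τ out<k) e)) stop)) accepts)

  open RuleCodes k I

  opaque
    fixedCode : ℕ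
    fixedCode = codeList (codesBelow (suc top))

    fixedCode-def : codeList (codesBelow (suc top)) ≡ fixedCode
    fixedCode-def = refl

  -- An `inc` instruction yields exactly one rule, so each chain state costs one `consCode`.
  chainCode : ℕ → ℕ
  chainCode zero    = fixedCode
  chainCode (suc j) = consCode (chainRuleCode variablesCode (sucAtCode 0) (j + top)) (chainCode j)

  opaque
    unfolding consCode chainRuleCode

    codesBelow-chain : ∀ j → codeList (codesBelow (suc (j + top))) ≡ chainCode j
    codesBelow-chain zero    = fixedCode-def
    codesBelow-chain (suc j) =
      trans (cong (λ ins → codeList (instrCodes (suc (j + top)) ins ++ codesBelow (suc (j + top)))) (I-chain j))
            (cong (consCode (chainRuleCode variablesCode (sucAtCode 0) (j + top))) (codesBelow-chain j))

  opaque
    unfolding truncation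

    code-truncation : ∀ b → code (truncation b) ≡
      systemCode (repeatCode k (suc (b + top))) (b + top) (listCode (Vec.replicate k zeroCode))
                   (chainCode b)
    code-truncation b = trans (code-system (b + top) (truncation-bounded b))
      (cong (systemCode (repeatCode k (suc (b + top))) (b + top) (listCode (Vec.replicate k zeroCode)))
            (codesBelow-chain b))

-- Recursive functions

record Computable {n} (f : Vec ℕ n → ℕ) : Set where
  field
    rec      : Rec n
    computes : ∀ xs → rec ⟨ xs ⟩⇓ f xs

open Computable

module _ {n : ℕ} where

  cong-C : {f g : Vec ℕ n → ℕ} → (∀ xs → f xs ≡ g xs) → Computable f → Computable g
  cong-C e c = record
    { rec = c .rec ; computes = λ xs → ≡-subst (c .rec ⟨ xs ⟩⇓_) (e xs) (c .computes xs) }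

  proj-C : (i : Fin n) → Computable (λ xs → Vec.lookup xs i)
  proj-C i = record { rec = proj i ; computes = λ _ → proj⇓ i }

  zero-C : Computable {n} (λ _ → 0)
  zero-C = record { rec = comp zer [] ; computes = λ _ → comp⇓ [] zer⇓ }

  suc-C : {f : Vec ℕ n → ℕ} → Computable f → Computable (λ xs → suc (f xs))
  suc-C c = record
    { rec = comp succ (c .rec ∷ []) ; computes = λ xs → comp⇓ (c .computes xs ∷ []) succ⇓ }

  const-C : ∀ c → Computable {n} (λ _ → c)
  const-C zero    = zero-C
  const-C (suc c) = suc-C (const-C c)

  natrec : (Vec ℕ n → ℕ) → (Vec ℕ (2 + n) → ℕ) → ℕ → Vec ℕ n → ℕ
  natrec z s zero    xs = z xs
  natrec z s (suc j) xs = s (j ∷ natrec z s j xs ∷ xs)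

  projections : ∀ (xs : Vec ℕ n) → Pointwise (λ h y → h ⟨ xs ⟩⇓ y) (Vec.tabulate proj) xs
  projections xs = ≡-subst (Pointwise _ _) (Vecₚ.tabulate∘lookup xs) (Pointwise.tabulate⁺ λ i → proj⇓ i)

  natrec-C : {z c : Vec ℕ n → ℕ} {s : Vec ℕ (2 + n) → ℕ} →
    Computable z → Computable s → Computable c → Computable (λ xs → natrec z s (c xs) xs)
  natrec-C {z} {c} {s} cz cs cc = record
    { rec      = comp (prec (cz .rec) (cs .rec)) (cc .rec ∷ Vec.tabulate proj)
    ; computes = λ xs → comp⇓ (cc .computes xs ∷ projections xs) (go (c xs) xs)
    }
    where
    go : ∀ j xs → prec (cz .rec) (cs .rec) ⟨ j ∷ xs ⟩⇓ natrec z s j xs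
    go zero    xs = prec⇓₀ (cz .computes xs)
    go (suc j) xs = prec⇓₊ (go j xs) (cs .computes _)

add-C : ∀ {n} {f g : Vec ℕ n → ℕ} → Computable f → Computable g → Computable (λ xs → f xs + g xs)
add-C {n} {f} {g} cf cg = cong-C (λ xs → eq (f xs) xs) (natrec-C cg (suc-C (proj-C 1F)) cf)
  where
  eq : ∀ j xs → natrec g (λ ys → suc (Vec.lookup ys 1F)) j xs ≡ j + g xs
  eq zero    xs = refl
  eq (suc j) xs = cong suc (eq j xs)

triangular-C : ∀ {n} {f : Vec ℕ n → ℕ} → Computable f → Computable (λ xs → triangular (f xs))
triangular-C {n} {f} cf =
  cong-C (λ xs → eq (f xs) xs)
         (natrec-C zero-C (add-C (suc-C (proj-C 0F)) (proj-C 1F)) cf)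
  where
  eq : ∀ j (xs : Vec ℕ n) →
    natrec (λ _ → 0) (λ ys → suc (Vec.lookup ys 0F) + Vec.lookup ys 1F) j xs ≡ triangular j
  eq zero    xs = refl
  eq (suc j) xs = cong (suc j +_) (eq j xs)

pair-C : ∀ {n} {f g : Vec ℕ n → ℕ} → Computable f → Computable g →
  Computable (λ xs → pair (f xs) (g xs))
pair-C cf cg = add-C (triangular-C (add-C cf cg)) cg

stateCode-C : ∀ {n} {f g : Vec ℕ n → ℕ} → Computable f → Computable g →
  Computable (λ xs → stateCode (f xs) (g xs))
stateCode-C cf cg = pair-C (add-C (const-C 5) cf) cg

opaque
  unfolding consCode chainRuleCode

  consCode-C : ∀ {n} {f g : Vec ℕ n → ℕ} → Computable f → Computable g →
    Computable (λ xs → consCode (f xs) (g xs))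
  consCode-C cf cg = suc-C (pair-C cf cg)

  chainRuleCode-C : ∀ {n} {v v₀ l : Vec ℕ n → ℕ} →
    Computable v → Computable v₀ → Computable l →
    Computable (λ xs → chainRuleCode (v xs) (v₀ xs) (l xs))
  chainRuleCode-C cv cv₀ cl = pair-C (stateCode-C (suc-C cl) cv) (stateCode-C cl cv₀)

repeatCode-C : ∀ {n} {f g : Vec ℕ n → ℕ} → Computable f → Computable g →
  Computable (λ xs → repeatCode (f xs) (g xs))
repeatCode-C {n} {f} {g} cf cg =
  cong-C (λ xs → eq (g xs) xs) (natrec-C zero-C step-C cg)
  where
  weaken : Computable (λ (ys : Vec ℕ (2 + n)) → f (Vec.tail (Vec.tail ys)))
  weaken = record
    { rec      = comp (cf .rec) (Vec.tabulate (λ i → proj (suc (suc i))))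
    ; computes = λ { (j ∷ r ∷ xs) → comp⇓
        (≡-subst (Pointwise _ _) (Vecₚ.tabulate∘lookup xs) (Pointwise.tabulate⁺ λ i → proj⇓ (suc (suc i))))
        (cf .computes xs) }
    }
  step-C : Computable (λ (ys : Vec ℕ (2 + n)) → consCode (f (Vec.tail (Vec.tail ys))) (Vec.lookup ys 1F))
  step-C = consCode-C weaken (proj-C 1F)
  eq : ∀ j xs → natrec (λ _ → 0) (λ ys → consCode (f (Vec.tail (Vec.tail ys))) (Vec.lookup ys 1F)) j xs
              ≡ repeatCode (f xs) j
  eq zero    xs = refl
  eq (suc j) xs = cong (consCode (f xs)) (eq j xs)

-- This is `chainCode` with its dependence on the program turned into numbers, hence computable
-- uniformly. In `diagonalCode` the number b serves both as base and as number of iterations.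
iterateCode : ℕ → ℕ → ℕ → ℕ → ℕ → ℕ
iterateCode v v₀ t b zero    = b
iterateCode v v₀ t b (suc j) = consCode (chainRuleCode v v₀ (j + t)) (iterateCode v v₀ t b j)

-- The argument vector is (b, k, v, v₀, z, d): b is the code of the fixed rules
-- and k, v, v₀, z and d are constants depending on the fixed program only.
diagonalCode : Vec ℕ 6 → ℕ
diagonalCode (b ∷ k ∷ v ∷ v₀ ∷ z ∷ d ∷ []) =
  systemCode (repeatCode k (suc (b + t))) (b + t) z (iterateCode v v₀ t b b)
  where
  t : ℕ
  t = 3 + (d + d)

opaque
  unfolding consCode systemCode

  systemCode-C : ∀ {n} {r m z c : Vec ℕ n → ℕ} →
    Computable r → Computable m → Computable z → Computable c →
    Computable (λ xs → systemCode (r xs) (m xs) (z xs) (c xs))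
  systemCode-C {n} cr cm cz cc = pair-C
    (cons 0 (cons 0 (cons 0 (cons 1 cr))))
    (consCode-C (pair-C (stateCode-C cm cz) (pair-C (const-C 1) zero-C)) cc)
    where
    cons : ∀ c {f : Vec ℕ n → ℕ} → Computable f → Computable (λ xs → consCode c (f xs))
    cons c = consCode-C (const-C c)

diagonalCode-C : Computable diagonalCode
diagonalCode-C = cong-C eq (systemCode-C (repeatCode-C (proj-C 1F) (suc-C m-C)) m-C (proj-C 4F) chain-C)
  where
  m : Vec ℕ 6 → ℕ
  m xs = Vec.lookup xs 0F + (3 + (Vec.lookup xs 5F + Vec.lookup xs 5F))
  m-C : Computable m
  m-C = add-C (proj-C 0F) (add-C (const-C 3) (add-C (proj-C 5F) (proj-C 5F)))
  label : Vec ℕ 8 → ℕ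
  label ys = Vec.lookup ys 0F + (3 + (Vec.lookup ys 7F + Vec.lookup ys 7F))
  label-C : Computable label
  label-C = add-C (proj-C 0F) (add-C (const-C 3) (add-C (proj-C 7F) (proj-C 7F)))
  step : Vec ℕ 8 → ℕ
  step ys = consCode (chainRuleCode (Vec.lookup ys 4F) (Vec.lookup ys 5F) (label ys)) (Vec.lookup ys 1F)
  step-C : Computable step
  step-C = consCode-C (chainRuleCode-C (proj-C 4F) (proj-C 5F) label-C) (proj-C 1F)
  chain : ℕ → Vec ℕ 6 → ℕ
  chain = natrec (λ xs → Vec.lookup xs 0F) step
  chain-C : Computable (λ xs → chain (Vec.lookup xs 0F) xs)
  chain-C = natrec-C (proj-C 0F) step-C (proj-C 0F)
  unfold : ∀ j b k v v₀ z d →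
    chain j (b ∷ k ∷ v ∷ v₀ ∷ z ∷ d ∷ []) ≡ iterateCode v v₀ (3 + (d + d)) b j
  unfold zero    b k v v₀ z d = refl
  unfold (suc j) b k v v₀ z d =
    cong (consCode (chainRuleCode v v₀ (j + (3 + (d + d))))) (unfold j b k v v₀ z d)
  eq : ∀ xs → systemCode (repeatCode (Vec.lookup xs 1F) (suc (m xs))) (m xs) (Vec.lookup xs 4F)
                (chain (Vec.lookup xs 0F) xs) ≡ diagonalCode xs
  eq (b ∷ k ∷ v ∷ v₀ ∷ z ∷ d ∷ []) =
    cong (systemCode (repeatCode k (suc (b + (3 + (d + d))))) (b + (3 + (d + d))) z)
         (unfold b b k v v₀ z d)

-- The diagonal program

load : ℕ → ℕ → Prog
load i zero    = []
load i (suc c) = inc i ∷ load i c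

width-load : ∀ i c → width (load i c) ≡ c
width-load i zero    = refl
width-load i (suc c) = cong suc (width-load i c)

load-below : ∀ {k} i c → i < k → Below k (load i c)
load-below i zero    i<k = tt
load-below i (suc c) i<k = i<k , load-below i c i<k

load-assigns : ∀ i c σ → Assigns (load i c) σ i (c + σ i)
load-assigns i zero    σ = σ , done , refl , λ _ _ → refl
load-assigns i (suc c) σ with load-assigns i c (update i (suc (σ i)) σ)
... | τ , run , v , fr =
  τ , inc run , trans v (trans (cong (c +_) (update-same i _ σ)) (+-suc c (σ i))) ,
  λ r r≢i → trans (fr r r≢i) (update-other i _ σ r r≢i)

loads : ∀ {n} → ℕ → Vec ℕ n → Prog
loads i []       = []
loads i (c ∷ cs) = load i c ++ loads (suc i) cs

-- Loading in unary costs one instruction per unit; this makes the length linear in the constants,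
-- so that one of them can describe it.
width-loads : ∀ {n} i (cs : Vec ℕ n) → width (loads i cs) ≡ Vec.sum cs
width-loads i []       = refl
width-loads i (c ∷ cs) = trans (width-++ (load i c) (loads (suc i) cs))
  (cong₂ _+_ (width-load i c) (width-loads (suc i) cs))

loads-below : ∀ {n k} i (cs : Vec ℕ n) → i + n ≤ k → Below k (loads i cs)
loads-below i []       b = tt
loads-below {suc n} i (c ∷ cs) b = below-++ (load i c)
  (load-below i c (<-≤-trans (m<m+n i z<s) b))
  (loads-below (suc i) cs (≤-trans (≤-reflexive (sym (+-suc i n))) b))

loads-runs : ∀ {n} i (cs : Vec ℕ n) σ → (∀ r → i ≤ r → σ r ≡ 0) →
  ∃ λ τ → loads i cs ⊢ σ ⇒ τ × Vec.map τ (range i n) ≡ cs ×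
          (∀ r → r < i ⊎ i + n ≤ r → τ r ≡ σ r)
loads-runs i []       σ z = σ , done , refl , λ _ _ → refl
loads-runs {suc n} i (c ∷ cs) σ z with load-assigns i c σ
... | τ₁ , run₁ , v₁ , fr₁
  with loads-runs (suc i) cs τ₁ (λ r i<r → trans (fr₁ r (≢-sym (<⇒≢ i<r))) (z r (<⇒≤ i<r)))
... | τ , run , vs , fr = τ , ⇒-++ run₁ run ,
  cong₂ _∷_ (trans (fr i (inj₁ (n<1+n i))) (trans v₁ (trans (cong (c +_) (z i ≤-refl)) (+-identityʳ c)))) vs ,
  λ where
    r (inj₁ r<i) → trans (fr r (inj₁ (m<n⇒m<1+n r<i))) (fr₁ r (<⇒≢ r<i))
    r (inj₂ b)   → trans (fr r (inj₂ (≤-trans (≤-reflexive (sym (+-suc i n))) b)))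
                         (fr₁ r (≢-sym (<⇒≢ (<-≤-trans (m<m+n i z<s) b))))

loads-compile-runs : ∀ {n} {q : Rec (suc n)} {b cs y} → q ⟨ b ∷ cs ⟩⇓ y →
  ∃ λ τ → loads 1 cs ++ compile q (range 0 (suc n)) (suc n) (2 + n) ⊢ input b ⇒ τ × τ (suc n) ≡ y
loads-compile-runs {n} {q} {b} {cs} q⇓ with loads-runs 1 cs (input b) (λ { (suc r) _ → refl })
... | τ₁ , run₁ , vs , fr₁
  with compile-correct q⇓ .Correct.assigns {range 0 (suc n)} {suc n} {2 + n} {τ₁}
         (Allᵛ.map (λ (_ , r<) → m<n⇒m<1+n r< , <⇒≢ r<) (range-bounds 0 (suc n)))
         ≤-refl (fr₁ (suc n) (inj₂ ≤-refl)) (λ { r@(suc _) b → fr₁ r (inj₂ (<⇒≤ b)) })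
         (cong₂ _∷_ (fr₁ 0 (inj₁ z<s)) vs)
... | τ , run , e , _ = τ , ⇒-++ run₁ run , e

module Diagonal (p : Rec 1) (decide : Rec 6)
  (decide⇓ : ∀ {xs y} → p ⟨ diagonalCode xs ∷ [] ⟩⇓ y → decide ⟨ xs ⟩⇓ y) where

  body : Prog
  body = compile decide (range 0 6) 6 7

  -- The number of registers comes from `body` alone, before the constants that depend on it;
  -- registers 0 to 5 are for the input and the constants, 6 is for the result.
  k₀ : ℕ
  k₀ = 6 + proj₁ (below-exists body)

  -- width main = d + d, so main can compute its own width from the constant d,
  -- which it loads.
  k v v₀ z d : ℕ
  k  = suc k₀
  v  = listCode (variableCodes 0 k)
  v₀ = listCode (modify 0 sucCode (variableCodes 0 k))
  z  = listCode (Vec.replicate k zeroCode)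
  d  = k + (v + (v₀ + (z + width body)))

  constants : Vec ℕ 5
  constants = k ∷ v ∷ v₀ ∷ z ∷ d ∷ []

  main : Prog
  main = loads 1 constants ++ body

  7≤k : 7 ≤ k
  7≤k = m≤m+n 7 _

  main-below : Below k main
  main-below = below-++ (loads 1 constants) (loads-below 1 constants (≤-trans (n≤1+n 6) 7≤k))
    (below-mono body (m≤n+m _ 7) (proj₂ (below-exists body)))

  width-main : width main ≡ d + d
  width-main = trans (width-++ (loads 1 constants) body)
    (trans (cong (_+ width body) (width-loads 1 constants))
      (solve 5 (λ k v v₀ z s →
          (k :+ (v :+ (v₀ :+ (z :+ ((k :+ (v :+ (v₀ :+ (z :+ s)))) :+ con 0))))) :+ s :=
          (k :+ (v :+ (v₀ :+ (z :+ s)))) :+ (k :+ (v :+ (v₀ :+ (z :+ s)))))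
        refl k v v₀ z (width body)))
    where open +-*-Solver

  open Layout k₀ main 6 7≤k main-below using (top; fixedCode; chainCode; truncation; truncation-linear;
    truncation-flat; truncation-height≤2; code-truncation; returns-suc; returns-zero)

  b : ℕ
  b = fixedCode

  chainCode-iterates : ∀ j → chainCode j ≡ iterateCode v v₀ top b j
  chainCode-iterates zero    = refl
  chainCode-iterates (suc j) = cong (consCode (chainRuleCode v v₀ (j + top))) (chainCode-iterates j)

  code-diagonal : code (truncation b) ≡ diagonalCode (b ∷ constants)
  code-diagonal = trans (code-truncation b)
    (trans (cong (systemCode (repeatCode k (suc (b + top))) (b + top) z) (chainCode-iterates b))
           (cong (λ t → systemCode (repeatCode k (suc (b + t))) (b + t) z (iterateCode v v₀ t b b))
                 (cong (3 +_) width-main)))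

  computation : ∀ {y} → p ⟨ code (truncation b) ∷ [] ⟩⇓ y → ∃ λ τ → main ⊢ input b ⇒ τ × τ 6 ≡ y
  computation {y} p⇓ = loads-compile-runs {cs = constants} (decide⇓ (≡-subst (λ c → p ⟨ c ∷ [] ⟩⇓ y) code-diagonal p⇓))

  -- The answer 1 makes the machine accept, which destroys `UN⁼`; the answer 0 sends it into the
  -- endless loop, which establishes `UN⁼`.
  contradicts : ¬ ((UN⁼ (truncation b) × p ⟨ code (truncation b) ∷ [] ⟩⇓ 1) ⊎
                   (¬ UN⁼ (truncation b) × p ⟨ code (truncation b) ∷ [] ⟩⇓ 0))
  contradicts (inj₁ (un , p⇓)) = let _ , run , e = computation p⇓ in returns-suc b run e un
  contradicts (inj₂ (¬un , p⇓)) = let _ , run , e = computation p⇓ in ¬un (returns-zero b run e)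

  undecided : ¬ ((R : TRS) → Linear R → LeftFlat R → RightHeight≤ 2 R →
    (UN⁼ R × p ⟨ code R ∷ [] ⟩⇓ 1) ⊎ (¬ UN⁼ R × p ⟨ code R ∷ [] ⟩⇓ 0))
  undecided decides = contradicts
    (decides (truncation b) (truncation-linear b) (truncation-flat b) (truncation-height≤2 b))

theorem4p12 : ¬ (∃ λ (p : Rec 1) →
    (R : TRS) → Linear R → LeftFlat R → RightHeight≤ 2 R →
    (UN⁼ R × p ⟨ code R ∷ [] ⟩⇓ 1) ⊎ (¬ UN⁼ R × p ⟨ code R ∷ [] ⟩⇓ 0))
-- The program to be run first computes the code of its own system from b and the constants, and
-- then consults `p`.
theorem4p12 (p , decides) = Diagonal.undecided p (comp p (diagonalCode-C .rec ∷ []))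
  (λ {xs} p⇓ → comp⇓ (diagonalCode-C .computes xs ∷ []) p⇓) decides
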